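{- Let $r\ge1$. The series $P_r(x,v)$ is a polynomial in $\mathbb Z[x,v]$, and it can be written as \[ P_r(x,v)=2c_{r,0}(x)+\sum_{\ell=1}^{r}c_{r,\ell}(x)(1-x)^{\ell-1}(1-2x)^{\ell}v^{\ell} \] with $c_{r,i}(x)\in\mathbb Z[x]$ for all $0\le i\le r$. Moreover: $\deg c_{r,0}(x)=3r-1$ for all $r\ge4$ and $c_{r,0}(1/2)=2^{1-r}$ for all $r\ge1$; and $\deg c_{r,\ell}(x)=3r-2\ell$ for all $r\ge4$ and all $1\le\ell\le r$.
   Context: The standard cycle form of a permutation $\sigma$ of $\{1,\dots,n\}$ writes $\sigma$ as a product of disjoint cycles (fixed points included as 1-cycles), each cycle written starting with its smallest letter, the cycles arranged in increasing order of their smallest letters. $\mathrm{Flatten}(\sigma)$ is the word obtained by erasing the parentheses of the standard cycle form. An occurrence of the pattern 13-2 in a word $w_1\cdots w_n$ is a pair of indices $(i,j)$ with $2\le i<j\le n$ and $w_{i-1}<w_j<w_i$. For $r\ge0$, $g_{n,r}(1i)$ denotes the number of permutations $\pi$ of $\{1,\dots,n\}$ such that $\mathrm{Flatten}(\pi)$ starts with $1i$ and has exactly $r$ occurrences of 13-2. Set $G_r(x,v)=\sum_{n\ge r+3}\sum_{i=2}^n g_{n,r}(1i)v^{i-2}x^n$ (a polynomial of degree $r$ in $v$ with coefficients in $\mathbb Z[[x]]$) and $P_r(x,v)=\frac{(1-x)^{2r-1}(1-2x)^{r+1}}{2x^{r+3}}G_r(x,v)$. The $c_{r,i}(x)$ are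 defined as the (a priori power series) coefficients in the displayed expansion of $P_r$ in powers of $v$. -}

module Defs where

open import Data.Bool using (Bool; true; false; if_then_else_; _∧_)
open import Data.Nat as ℕ using (ℕ; zero; suc; _∸_; _≤ᵇ_; _<ᵇ_; _≡ᵇ_)
open import Data.Integer as ℤ using (ℤ; +_)
open import Data.List using (List; []; _∷_; length; concatMap; map)
import Data.Rational as ℚ
open import Relation.Binary.PropositionalEquality using (_≡_; _≢_)
open import Data.Product using (_×_)

range1 : ℕ → List ℕ
range1 n = go n []
  where
  go : ℕ → List ℕ → List ℕ
  go zero acc = acc
  go (suc k) acc = go k (suc k ∷ acc)

filterB : {A : Set} → (A → Bool) → List A → List A
filterB p [] = []
filterB p (x ∷ xs) = if p x then x ∷ filterB p xs else filterB p xs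

words : ℕ → ℕ → List (List ℕ)
words n zero = [] ∷ []
words n (suc k) = concatMap (λ a → map (a ∷_) (words n k)) (range1 n)

member : ℕ → List ℕ → Bool
member x [] = false
member x (y ∷ ys) = if x ≡ᵇ y then true else member x ys

distinct : List ℕ → Bool
distinct [] = true
distinct (x ∷ xs) = if member x xs then false else distinct xs

-- the permutations of {1..n}, in one-line notation w = σ(1) σ(2) ... σ(n):
-- exactly the words of length n over {1..n} with pairwise distinct letters
perms : ℕ → List (List ℕ)
perms n = filterB distinct (words n n)

-- σ(i) for σ given in one-line notation (1-based; 0 outside the range)
apply : List ℕ → ℕ → ℕ
apply [] i = 0
apply (x ∷ xs) zero = 0
apply (x ∷ xs) (suc zero) = x
apply (x ∷ xs) (suc (suc i)) = apply xs (suc i)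

-- the cycle of σ through m, written starting at m:  m, σ(m), σ²(m), ...
-- (stopping before returning to m; the fuel n = length w bounds the cycle length)
cycleOf : List ℕ → ℕ → List ℕ
cycleOf w m = m ∷ go (length w) (apply w m)
  where
  go : ℕ → ℕ → List ℕ
  go zero x = []
  go (suc f) x = if x ≡ᵇ m then [] else x ∷ go f (apply w x)

isCycleMin : List ℕ → ℕ → Bool
isCycleMin w m = allLeq (cycleOf w m)
  where
  allLeq : List ℕ → Bool
  allLeq [] = true
  allLeq (x ∷ xs) = (m ≤ᵇ x) ∧ allLeq xs

-- Flatten(σ): the standard cycle form (each cycle started at its smallest
-- letter, cycles in increasing order of smallest letters) with the
-- parentheses erased
flatten : List ℕ → List ℕ
flatten w = concatMap (λ m → if isCycleMin w m then cycleOf w m else [])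
                      (range1 (length w))

countBetween : ℕ → ℕ → List ℕ → ℕ
countBetween a b [] = 0
countBetween a b (c ∷ cs) =
  if (a <ᵇ c) ∧ (c <ᵇ b) then suc (countBetween a b cs) else countBetween a b cs

-- number of occurrences of 13-2 in w_1...w_n: pairs (i,j), 2 ≤ i < j ≤ n,
-- with w_{i-1} < w_j < w_i
occ13-2 : List ℕ → ℕ
occ13-2 (a ∷ b ∷ rest) = countBetween a b rest ℕ.+ occ13-2 (b ∷ rest)
occ13-2 _ = 0

startsWith1 : ℕ → List ℕ → Bool
startsWith1 i (a ∷ b ∷ _) = (a ≡ᵇ 1) ∧ (b ≡ᵇ i)
startsWith1 i _ = false

g : ℕ → ℕ → ℕ → ℕ
g n r i = length (filterB (λ w → startsWith1 i (flatten w) ∧ (occ13-2 (flatten w) ≡ᵇ r))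
                          (perms n))

Series : Set
Series = ℕ → ℤ

sumTo : (ℕ → ℤ) → ℕ → ℤ
sumTo f zero = f 0
sumTo f (suc n) = sumTo f n ℤ.+ f (suc n)

_⊛_ : Series → Series → Series
(f ⊛ h) n = sumTo (λ j → f j ℤ.* h (n ∸ j)) n

oneS : Series
oneS zero = + 1
oneS (suc _) = + 0

powS : Series → ℕ → Series
powS f zero = oneS
powS f (suc k) = f ⊛ powS f k

oneMinusX : Series
oneMinusX zero = + 1
oneMinusX (suc zero) = ℤ.- (+ 1)
oneMinusX (suc (suc _)) = + 0

oneMinus2X : Series
oneMinus2X zero = + 1
oneMinus2X (suc zero) = ℤ.- (+ 2)
oneMinus2X (suc (suc _)) = + 0

shiftS : ℕ → Series → Series
shiftS k f n = if n <ᵇ k then + 0 else f (n ∸ k)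

scaleS : ℤ → Series → Series
scaleS a f n = a ℤ.* f n

-- Polynomials in ℤ[x] as coefficient lists (constant term first)

coeff : List ℤ → ℕ → ℤ
coeff [] n = + 0
coeff (a ∷ as) zero = a
coeff (a ∷ as) (suc n) = coeff as n

HasDegree : List ℤ → ℕ → Set
HasDegree p d = (coeff p d ≢ + 0) × (∀ i → d ℕ.< i → coeff p i ≡ + 0)

evalHalf : List ℤ → ℚ.ℚ
evalHalf [] = ℚ.0ℚ
evalHalf (a ∷ as) = (a ℚ./ 1) ℚ.+ (ℚ.½ ℚ.* evalHalf as)

powQ : ℚ.ℚ → ℕ → ℚ.ℚ
powQ q zero = ℚ.1ℚ
powQ q (suc k) = q ℚ.* powQ q k

-- [v^k] G_r(x,v) = Σ_{n ≥ r+3} g_{n,r}(1(k+2)) x^n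
Gcoeff : ℕ → ℕ → Series
Gcoeff r k n = if (r ℕ.+ 3) ≤ᵇ n then + (g n r (k ℕ.+ 2)) else + 0

-- [v^k] (1-x)^{2r-1} (1-2x)^{r+1} G_r(x,v)  ( = [v^k] 2 x^{r+3} P_r(x,v) )
numer : ℕ → ℕ → Series
numer r k = (powS oneMinusX (2 ℕ.* r ∸ 1) ⊛ powS oneMinus2X (r ℕ.+ 1)) ⊛ Gcoeff r k

{-# OPTIONS --safe #-}
-- A word u is Flatten(σ) for exactly 2^(m-1) permutations σ, where m is the number of
-- right-to-left minima of u: cycles start at right-to-left minima, and apart from the first
-- letter each of these may or may not start a new cycle.  Deleting the leading 1 (and then
-- successive first letters) gives a linear recurrence for the numbers U m j s below, and
-- g (m+2) r (k+2) = 2 U m k (r-k).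
--
-- For fixed j + s = r the sequence a j s i = U (r+i) j s satisfies, with S the shift,
--   (S-1) a j s = Σ_{k<j} S^(j-k) a k s + Σ_{1≤t≤s} a (j+t) (s-t)    (j ≥ 1),
--   (S-2) a 0 s = 2 Σ_{1≤t≤s} a t (s-t),
-- so that a j s is annihilated by a product (S-1)^p (S-2)^q.  Hence its generating function
-- is a proper fraction over (1-x)^p (1-2x)^q.  The series in the theorem omits the first term
-- a j s 0 of this one; the numerator c_ℓ therefore has degree p+q-1, with leading coefficient
-- -a j s 0 (halved if j = 0) times that of the denominator, which is nonzero as soon as r ≥ 4.
-- The value c_0(1/2) is, up to normalisation, the coefficient of the highest power of i in
-- front of 2^i in a 0 r, which the recurrences determine.
module Submission where

open import Defs

-- No arbitrary permutation is ever decomposed into cycles. Permutations are instead built edge by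
-- edge in the order in which `flatten` reads them; the edges are kept because the bare word forgets
-- where cycles close. Such an edge list can be read back from the permutation that it encodes, so
-- the encoding is injective. There are n! edge lists and at most n! permutations, so it is also
-- onto.
--
-- The exponents in the theorem come from the weight `j + 2s`. In the recurrence for `a j s` with j
-- ≥ 1, the terms `a k s` with k < j and `a (j+t) (s-t)` with t ≥ 1 all have smaller weight, so one
-- further factor `S - 1` per unit of weight is enough, while factors `S - 2` enter only when the
-- rank is 0. This gives p = j + 2s and q = s + 1. For j = ℓ ≥ 1 and s = r - ℓ these are 2r - ℓ and
-- r - ℓ + 1, exactly what is left of (1-x)^(2r-1) (1-2x)^(r+1) once (1-x)^(ℓ-1) (1-2x)^ℓ is split
-- off.

module Enumeration where

  open import Data.Bool as Bool using (Bool; true; false; if_then_else_; _∧_; not)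
  open import Data.Empty using (⊥)
  open import Data.Nat
  open import Data.Nat.ListAction using (sum)
  import Data.Nat.Properties as ℕ
  open import Data.Nat.Tactic.RingSolver using (solve-∀)
  open import Data.List using (List; []; _∷_; [_]; length; _++_; map; concatMap)
  open import Data.List.Properties
  open import Data.List.Membership.Propositional using (_∈_; _∉_; find; lose)
  open import Data.List.Membership.Propositional.Properties
  open import Data.List.Relation.Unary.Any using (here; there)
  open import Data.List.Relation.Unary.All as All using (All; []; _∷_)
  import Data.List.Relation.Unary.All.Properties as All
  open import Data.List.Relation.Unary.AllPairs as AllPairs using (AllPairs; []; _∷_)
  import Data.List.Relation.Unary.AllPairs.Properties as AllPairs
  open import Data.List.Relation.Unary.Unique.Propositional using (Unique)
  import Data.List.Relation.Unary.Unique.Propositional.Properties as Unique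
  open import Data.List.Relation.Binary.Permutation.Propositional as ↭
    using (_↭_; ↭-sym; ↭-trans; ↭⇒↭ₛ)
  import Data.List.Relation.Binary.Permutation.Propositional.Properties as ↭
  import Data.List.Relation.Binary.Permutation.Setoid.Properties as Setoid↭
  open import Data.List.Relation.Binary.Subset.Propositional using (_⊆_)
  open import Data.Product using (_×_; _,_; ∃; proj₁; proj₂)
  open import Data.Sum as Sum using (_⊎_; inj₁; inj₂)
  open import Data.Unit using (tt)
  open import Function using (_∘_; id; case_of_)
  open import Relation.Nullary using (contradiction)
  open import Relation.Binary.PropositionalEquality hiding ([_])

  private variable
    A B : Set

  -- Finite sums and the recurrence for `U`.

  ∑ : ℕ → (ℕ → ℕ) → ℕ
  ∑ zero    f = 0
  ∑ (suc n) f = f 0 + ∑ n (f ∘ suc)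

  ∑-cong : ∀ n {f h : ℕ → ℕ} → (∀ k → k < n → f k ≡ h k) → ∑ n f ≡ ∑ n h
  ∑-cong zero    f≡h = refl
  ∑-cong (suc n) f≡h = cong₂ _+_ (f≡h 0 (s≤s z≤n)) (∑-cong n (λ k k<n → f≡h (suc k) (s≤s k<n)))

  ∑-zero : ∀ n {f : ℕ → ℕ} → (∀ k → k < n → f k ≡ 0) → ∑ n f ≡ 0
  ∑-zero zero    f≡0 = refl
  ∑-zero (suc n) f≡0 = cong₂ _+_ (f≡0 0 (s≤s z≤n)) (∑-zero n (λ k k<n → f≡0 (suc k) (s≤s k<n)))

  ∑-split : ∀ m n f → ∑ (m + n) f ≡ ∑ m f + ∑ n (λ t → f (t + m))
  ∑-split zero    n f = ∑-cong n (λ k _ → cong f (sym (ℕ.+-identityʳ k)))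
  ∑-split (suc m) n f = begin
    f 0 + ∑ (m + n) (f ∘ suc)
      ≡⟨ cong (f 0 +_) (∑-split m n (f ∘ suc)) ⟩
    f 0 + (∑ m (f ∘ suc) + ∑ n (λ t → f (suc (t + m))))
      ≡⟨ ℕ.+-assoc (f 0) _ _ ⟨
    ∑ (suc m) f + ∑ n (λ t → f (suc (t + m)))
      ≡⟨ cong (∑ (suc m) f +_) (∑-cong n (λ k _ → cong f (sym (ℕ.+-suc k m)))) ⟩
    ∑ (suc m) f + ∑ n (λ t → f (t + suc m)) ∎
    where open ≡-Reasoning

  ∑-≥ : ∀ n f k → k < n → f k ≤ ∑ n f
  ∑-≥ (suc n) f zero    _         = ℕ.m≤m+n (f 0) _
  ∑-≥ (suc n) f (suc k) (s≤s k<n) = ℕ.≤-trans (∑-≥ n (f ∘ suc) k k<n) (ℕ.m≤n+m _ (f 0))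

  ∑-distrib : ∀ n c f → ∑ n (λ k → c * f k) ≡ c * ∑ n f
  ∑-distrib zero    c f = sym (ℕ.*-zeroʳ c)
  ∑-distrib (suc n) c f = trans (cong (c * f 0 +_) (∑-distrib n c (f ∘ suc)))
                                (sym (ℕ.*-distribˡ-+ c (f 0) (∑ n (f ∘ suc))))

  -- Multiplication by the d-th power of the variable that marks occurrences: the value at `s ∸ d`,
  -- but 0 rather than `f 0` when `s < d`.
  lag : (ℕ → ℕ) → ℕ → ℕ → ℕ
  lag f s       zero    = f s
  lag f zero    (suc d) = 0
  lag f (suc s) (suc d) = lag f s d

  lag-≤ : ∀ f {s d} → d ≤ s → lag f s d ≡ f (s ∸ d)
  lag-≤ f {s}             z≤n       = refl
  lag-≤ f {suc s} {suc d} (s≤s d≤s) = lag-≤ f d≤s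

  lag-> : ∀ f {s d} → s < d → lag f s d ≡ 0
  lag-> f {zero}  {suc d} _         = refl
  lag-> f {suc s} {suc d} (s≤s s<d) = lag-> f s<d

  -- The argument is a rank: a letter with no smaller letter after it is a right-to-left minimum and
  -- carries weight 2.
  ω : ℕ → ℕ
  ω zero    = 2
  ω (suc _) = 1

  -- For j ≤ m, 2 U m j s is the number of permutations of {1..m+1}, each weighted by 2 to the
  -- number of right-to-left minima, that start with j+1 and have s occurrences of 13-2.
  U Y : ℕ → ℕ → ℕ → ℕ
  U zero    j zero    = 1
  U zero    j (suc s) = 0
  U (suc m) j s       = ω j * Y m j s
  Y m j s = ∑ (suc m) (λ k → lag (U m k) s (k ∸ j))

  -- Since `m ≥ j + s`, every next letter that can contribute is available: below rank j it costs
  -- nothing, at rank `t + j` it costs t occurrences, and beyond rank `j + s` it would cost more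
  -- than s.
  Y-split : ∀ j s i → let m = j + s + i in
            Y m j s ≡ ∑ j (λ k → U m k s) + ∑ (suc s) (λ t → U m (t + j) (s ∸ t))
  Y-split j s i = begin
    ∑ (suc m) φ
      ≡⟨ cong (λ l → ∑ l φ) (len j s i) ⟩
    ∑ (j + (suc s + i)) φ
      ≡⟨ ∑-split j (suc s + i) φ ⟩
    ∑ j φ + ∑ (suc s + i) (λ t → φ (t + j))
      ≡⟨ cong₂ _+_ (∑-cong j (λ k k<j → cong (lag (U m k) s) (ℕ.m≤n⇒m∸n≡0 (ℕ.<⇒≤ k<j))))
                     (∑-split (suc s) i (λ t → φ (t + j))) ⟩
    ∑ j (λ k → U m k s) + (∑ (suc s) (λ t → φ (t + j)) + ∑ i (λ t → φ (t + suc s + j)))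
      ≡⟨ cong (∑ j (λ k → U m k s) +_)
              (cong₂ _+_ (∑-cong (suc s) inside) (∑-zero i (λ t _ → outside t))) ⟩
    ∑ j (λ k → U m k s) + (∑ (suc s) (λ t → U m (t + j) (s ∸ t)) + 0)
      ≡⟨ cong (∑ j (λ k → U m k s) +_) (ℕ.+-identityʳ _) ⟩
    ∑ j (λ k → U m k s) + ∑ (suc s) (λ t → U m (t + j) (s ∸ t)) ∎
    where
    open ≡-Reasoning
    m = j + s + i
    φ = λ k → lag (U m k) s (k ∸ j)
    len : ∀ j s i → suc (j + s + i) ≡ j + (suc s + i)
    len = solve-∀
    inside : ∀ t → t < suc s → φ (t + j) ≡ U m (t + j) (s ∸ t)
    inside t (s≤s t≤s) = trans (cong (lag (U m (t + j)) s) (ℕ.m+n∸n≡m t j)) (lag-≤ (U m (t + j)) t≤s)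
    outside : ∀ t → φ (t + suc s + j) ≡ 0
    outside t = trans (cong (lag (U m (t + suc s + j)) s) (ℕ.m+n∸n≡m (t + suc s) j))
                      (lag-> (U m (t + suc s + j)) (ℕ.m≤n+m (suc s) t))

  -- The local functions inside the definitions.

  orbit : List ℕ → ℕ → ℕ → ℕ → List ℕ
  orbit w m zero    x = []
  orbit w m (suc f) x = if x ≡ᵇ m then [] else x ∷ orbit w m f (apply w x)

  -- The underscore is solved to the local function of cycleOf, which has no name out of its scope;
  -- likewise for isCycleMin and range1 below.
  cycleOf-orbit : ∀ w m → cycleOf w m ≡ m ∷ orbit w m (length w) (apply w m)
  go-orbit : ∀ w m f x → _ ≡ orbit w m f x
  cycleOf-orbit w m with length w | apply w m
  ... | f | x = cong (m ∷_) (go-orbit w m f x)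
  go-orbit w m zero    x = refl
  go-orbit w m (suc f) x with x ≡ᵇ m
  ... | true  = refl
  ... | false = cong (x ∷_) (go-orbit w m f (apply w x))

  all≥ : ℕ → List ℕ → Bool
  all≥ m []       = true
  all≥ m (x ∷ xs) = (m ≤ᵇ x) ∧ all≥ m xs

  isCycleMin-all≥ : ∀ w m → isCycleMin w m ≡ all≥ m (cycleOf w m)
  allLeq-all≥ : ∀ w m xs → _ ≡ all≥ m xs
  isCycleMin-all≥ w m rewrite go-orbit w m (length w) (apply w m)
    with orbit w m (length w) (apply w m)
  ... | xs = cong ((m ≤ᵇ m) ∧_) (allLeq-all≥ w m xs)
  allLeq-all≥ w m []       = refl
  allLeq-all≥ w m (x ∷ xs) = cong ((m ≤ᵇ x) ∧_) (allLeq-all≥ w m xs)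

  interval : ℕ → ℕ → List ℕ
  interval x zero    = []
  interval x (suc n) = x ∷ interval (suc x) n

  interval-snoc : ∀ x n → interval x (suc n) ≡ interval x n ++ (x + n ∷ [])
  interval-snoc x zero    = cong (_∷ []) (sym (ℕ.+-identityʳ x))
  interval-snoc x (suc n) = cong (x ∷_) (trans (interval-snoc (suc x) n)
    (cong (λ z → interval (suc x) n ++ (z ∷ [])) (sym (ℕ.+-suc x n))))

  range1-interval : ∀ n → range1 n ≡ interval 1 n
  go-interval : ∀ p k acc → _ ≡ interval 1 k ++ acc
  range1-interval zero = refl
  range1-interval (suc n) = trans (start n) (sym (interval-snoc 1 n))
    where
    start : ∀ n → range1 (suc n) ≡ interval 1 n ++ (suc n ∷ [])
    start n with suc n
    ... | p with [ p ]
    ... | acc = go-interval p n acc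
  go-interval p zero acc = refl
  go-interval p (suc k) acc = trans (go-interval p k (suc k ∷ acc))
    (trans (sym (++-assoc (interval 1 k) _ acc)) (cong (_++ acc) (sym (interval-snoc 1 k))))

  -- Counting in lists, and an upper bound for the number of permutations.

  count : (A → Bool) → List A → ℕ
  count p xs = length (filterB p xs)

  count-cong : ∀ {p q : A → Bool} xs → (∀ {x} → x ∈ xs → p x ≡ q x) → count p xs ≡ count q xs
  count-cong []       p≡q = refl
  count-cong {p = p} {q} (x ∷ xs) p≡q with p x | q x | p≡q (here refl) | count-cong xs (p≡q ∘ there)
  ... | true  | .true  | refl | ih = cong suc ih
  ... | false | .false | refl | ih = ih

  count-++ : ∀ (p : A → Bool) xs ys → count p (xs ++ ys) ≡ count p xs + count p ys
  count-++ p []       ys = refl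
  count-++ p (x ∷ xs) ys with p x
  ... | true  = cong suc (count-++ p xs ys)
  ... | false = count-++ p xs ys

  count-map : ∀ (p : B → Bool) (f : A → B) xs → count p (map f xs) ≡ count (p ∘ f) xs
  count-map p f []       = refl
  count-map p f (x ∷ xs) with p (f x)
  ... | true  = cong suc (count-map p f xs)
  ... | false = count-map p f xs

  count-concatMap : ∀ (p : B → Bool) (f : A → List B) xs →
                    count p (concatMap f xs) ≡ sum (map (count p ∘ f) xs)
  count-concatMap p f []       = refl
  count-concatMap p f (x ∷ xs) = trans (count-++ p (f x) (concatMap f xs))
                                       (cong (count p (f x) +_) (count-concatMap p f xs))

  count-↭ : ∀ (p : A → Bool) {xs ys} → xs ↭ ys → count p xs ≡ count p ys
  count-↭ p ↭.refl = refl
  count-↭ p (↭.prep x xs↭ys) with p x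
  ... | true  = cong suc (count-↭ p xs↭ys)
  ... | false = count-↭ p xs↭ys
  count-↭ p (↭.swap x y xs↭ys) with p x | p y
  ... | true  | true  = cong (suc ∘ suc) (count-↭ p xs↭ys)
  ... | true  | false = cong suc (count-↭ p xs↭ys)
  ... | false | true  = cong suc (count-↭ p xs↭ys)
  ... | false | false = count-↭ p xs↭ys
  count-↭ p (↭.trans xs↭ys ys↭zs) = trans (count-↭ p xs↭ys) (count-↭ p ys↭zs)

  count-false : ∀ (xs : List A) → count (λ _ → false) xs ≡ 0
  count-false []       = refl
  count-false (x ∷ xs) = count-false xs

  count-not : ∀ (p : A → Bool) xs → count p xs + count (not ∘ p) xs ≡ length xs
  count-not p []       = refl
  count-not p (x ∷ xs) with p x
  ... | true  = cong suc (count-not p xs)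
  ... | false = trans (ℕ.+-suc _ _) (cong suc (count-not p xs))

  ∈-filterB⁺ : ∀ (p : A → Bool) {x xs} → x ∈ xs → p x ≡ true → x ∈ filterB p xs
  ∈-filterB⁺ p {x} {y ∷ xs} (here refl)  px with p y
  ∈-filterB⁺ p {x} {y ∷ xs} (here refl)  refl | true = here refl
  ∈-filterB⁺ p {x} {y ∷ xs} (there x∈xs) px with p y
  ... | true  = there (∈-filterB⁺ p x∈xs px)
  ... | false = ∈-filterB⁺ p x∈xs px

  unique-⊆-↭ : ∀ {xs ys : List A} → Unique xs → xs ⊆ ys → ∃ λ zs → ys ↭ xs ++ zs
  unique-⊆-↭ {xs = []}     {ys} _          _     = ys , ↭.refl
  unique-⊆-↭ {xs = x ∷ xs} {ys} (x∉ ∷ xs!) xs⊆ys with ∈-∃++ (xs⊆ys (here refl))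
  ... | ps , qs , refl with unique-⊆-↭ {ys = ps ++ qs} xs! rest
    where
    rest : xs ⊆ ps ++ qs
    rest y∈xs with ∈-++⁻ ps (xs⊆ys (there y∈xs))
    ... | inj₁ y∈ps         = ∈-++⁺ˡ y∈ps
    ... | inj₂ (here refl)  = contradiction refl (All.lookup x∉ y∈xs)
    ... | inj₂ (there y∈qs) = ∈-++⁺ʳ ps y∈qs
  ... | zs , eq = zs , ↭.trans (↭.shift x ps qs) (↭.prep x eq)

  unique-⊆-length : ∀ {xs ys : List A} → Unique xs → xs ⊆ ys → length xs ≤ length ys
  unique-⊆-length {xs = xs} xs! xs⊆ys with unique-⊆-↭ xs! xs⊆ys
  ... | zs , eq = subst (length xs ≤_) (sym (trans (↭.↭-length eq) (length-++ xs))) (ℕ.m≤m+n _ _)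

  unique-⊆-≥-↭ : ∀ {xs ys : List A} → Unique xs → xs ⊆ ys → length ys ≤ length xs → ys ↭ xs
  unique-⊆-≥-↭ {xs = xs} xs! xs⊆ys ys≤ with unique-⊆-↭ xs! xs⊆ys
  ... | []     , eq = subst (_ ↭_) (++-identityʳ xs) eq
  ... | z ∷ zs , eq = contradiction
    (subst (_≤ length xs) (trans (↭.↭-length eq) (trans (length-++ xs) (ℕ.+-suc _ _))) ys≤)
    (ℕ.<⇒≱ (s≤s (ℕ.m≤m+n (length xs) (length zs))))

  ≡ᵇ-true : ∀ x → (x ≡ᵇ x) ≡ true
  ≡ᵇ-true zero    = refl
  ≡ᵇ-true (suc x) = ≡ᵇ-true x

  ≡ᵇ-false : ∀ {x y} → x ≢ y → (x ≡ᵇ y) ≡ false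
  ≡ᵇ-false {zero}  {zero}  x≢y = contradiction refl x≢y
  ≡ᵇ-false {zero}  {suc y} x≢y = refl
  ≡ᵇ-false {suc x} {zero}  x≢y = refl
  ≡ᵇ-false {suc x} {suc y} x≢y = ≡ᵇ-false (x≢y ∘ cong suc)

  member-true : ∀ {x xs} → x ∈ xs → member x xs ≡ true
  member-true {x} (here refl) rewrite ≡ᵇ-true x = refl
  member-true {x} {y ∷ xs} (there x∈xs) with x ≡ᵇ y
  ... | true  = refl
  ... | false = member-true x∈xs

  member-false : ∀ {x xs} → All (x ≢_) xs → member x xs ≡ false
  member-false []            = refl
  member-false (x≢y ∷ x∉) rewrite ≡ᵇ-false x≢y = member-false x∉

  distinct-true : ∀ {xs} → Unique xs → distinct xs ≡ true
  distinct-true []         = refl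
  distinct-true (x∉ ∷ xs!) rewrite member-false x∉ = distinct-true xs!

  distinct-unique : ∀ xs → distinct xs ≡ true → Unique xs
  distinct-unique []       _  = []
  distinct-unique (x ∷ xs) d with member x xs in eq
  ... | false = All.tabulate (λ y∈ x≡y → case trans (sym (member-true (subst (_∈ xs) (sym x≡y) y∈))) eq of λ ())
                ∷ distinct-unique xs d

  ∈-words⁺ : ∀ {n w} → w ⊆ range1 n → w ∈ words n (length w)
  ∈-words⁺ {w = []}    _  = here refl
  ∈-words⁺ {n} {x ∷ w} w⊆ = ∈-concatMap⁺ (λ a → map (a ∷_) (words n (length w)))
    (lose (w⊆ (here refl)) (∈-map⁺ (x ∷_) (∈-words⁺ (w⊆ ∘ there))))

  ∈-words⁻ : ∀ {n} k {w} → w ∈ words n k → w ⊆ range1 n × length w ≡ k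
  ∈-words⁻ zero    (here refl) = (λ ()) , refl
  ∈-words⁻ {n} (suc k) w∈ with find (∈-concatMap⁻ (λ a → map (a ∷_) (words n k)) {xs = range1 n} w∈)
  ... | a , a∈ , w∈map with ∈-map⁻ (a ∷_) w∈map
  ... | u , u∈ , refl with ∈-words⁻ k u∈
  ... | u⊆ , len = (λ { (here refl) → a∈ ; (there y∈) → u⊆ y∈ }) , cong suc len

  ∈-perms⁺ : ∀ {n w} → w ⊆ range1 n → length w ≡ n → Unique w → w ∈ perms n
  ∈-perms⁺ {n} {w} w⊆ len w! =
    ∈-filterB⁺ distinct (subst (λ k → w ∈ words n k) len (∈-words⁺ w⊆)) (distinct-true w!)

  length-interval : ∀ x n → length (interval x n) ≡ n
  length-interval x zero    = refl
  length-interval x (suc n) = cong suc (length-interval (suc x) n)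

  length-range1 : ∀ n → length (range1 n) ≡ n
  length-range1 n = trans (cong length (range1-interval n)) (length-interval 1 n)

  sum-count-swap : ∀ (p : A → B → Bool) xs ys →
    sum (map (λ x → count (p x) ys) xs) ≡ sum (map (λ y → count (λ x → p x y) xs) ys)
  sum-count-swap p []       ys = sym (zeros ys)
    where
    zeros : ∀ ys → sum (map (λ _ → 0) ys) ≡ 0
    zeros []       = refl
    zeros (y ∷ ys) = zeros ys
  sum-count-swap p (x ∷ xs) ys = trans (cong (count (p x) ys +_) (sum-count-swap p xs ys)) (add ys)
    where
    shuffle : ∀ a b c → a + (b + c) ≡ b + (a + c)
    shuffle = solve-∀
    add : ∀ ys → count (p x) ys + sum (map (λ y → count (λ x → p x y) xs) ys)
               ≡ sum (map (λ y → count (λ x → p x y) (x ∷ xs)) ys)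
    add []       = refl
    add (y ∷ ys) with p x y
    ... | true  = cong suc (trans (shuffle (count (p x) ys) (count (λ x → p x y) xs) _)
                                  (cong (count (λ x → p x y) xs +_) (add ys)))
    ... | false = trans (shuffle (count (p x) ys) (count (λ x → p x y) xs) _)
                        (cong (count (λ x → p x y) xs +_) (add ys))

  -- The k letters of w are distinct and lie among the n available ones, so setting them aside
  -- leaves at most n - k.
  count-fresh : ∀ n k {w} → w ∈ words n k → distinct w ≡ true →
                count (λ a → not (member a w)) (range1 n) ≤ n ∸ k
  count-fresh n k {w} w∈ d with ∈-words⁻ k w∈
  ... | w⊆ , refl = subst (_≤ n ∸ length w) complement
    (ℕ.∸-monoʳ-≤ n (unique-⊆-length (distinct-unique w d)
      (λ x∈w → ∈-filterB⁺ used (w⊆ x∈w) (member-true x∈w))))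
    where
    used : ℕ → Bool
    used a = member a w
    complement : n ∸ count used (range1 n) ≡ count (not ∘ used) (range1 n)
    complement = trans
      (cong (_∸ count used (range1 n)) (sym (trans (count-not used (range1 n)) (length-range1 n))))
      (ℕ.m+n∸m≡n (count used (range1 n)) (count (not ∘ used) (range1 n)))

  -- After the summations are exchanged, each duplicate-free tail is charged with the letters that
  -- it does not use, and a tail with a repetition contributes 0.
  count-distinct-suc : ∀ n k → count distinct (words n (suc k)) ≤ (n ∸ k) * count distinct (words n k)
  count-distinct-suc n k = begin
    count distinct (concatMap (λ a → map (a ∷_) (words n k)) (range1 n))
      ≡⟨ count-concatMap distinct (λ a → map (a ∷_) (words n k)) (range1 n) ⟩
    sum (map (λ a → count distinct (map (a ∷_) (words n k))) (range1 n))
      ≡⟨ cong sum (map-cong (λ a → count-map distinct (a ∷_) (words n k)) (range1 n)) ⟩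
    sum (map (λ a → count (λ u → distinct (a ∷ u)) (words n k)) (range1 n))
      ≡⟨ sum-count-swap (λ a u → distinct (a ∷ u)) (range1 n) (words n k) ⟩
    sum (map (λ u → count (λ a → distinct (a ∷ u)) (range1 n)) (words n k))
      ≤⟨ bound (words n k) (λ u∈ → u∈) ⟩
    (n ∸ k) * count distinct (words n k) ∎
    where
    open ℕ.≤-Reasoning
    bound : ∀ us → us ⊆ words n k →
            sum (map (λ u → count (λ a → distinct (a ∷ u)) (range1 n)) us) ≤ (n ∸ k) * count distinct us
    bound []       _  = z≤n
    bound (u ∷ us) us⊆ with distinct u in eq
    ... | true  = ℕ.≤-trans
      (ℕ.+-mono-≤ (ℕ.≤-trans (ℕ.≤-reflexive (count-cong (range1 n) (λ {a} _ → neg (member a u))))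
                             (count-fresh n k (us⊆ (here refl)) eq))
                  (bound us (us⊆ ∘ there)))
      (ℕ.≤-reflexive (sym (ℕ.*-suc (n ∸ k) (count distinct us))))
      where
      neg : ∀ b → (if b then false else true) ≡ not b
      neg true  = refl
      neg false = refl
    ... | false = ℕ.≤-trans (ℕ.≤-reflexive (cong (_+ _) none)) (bound us (us⊆ ∘ there))
      where
      both : ∀ b → (if b then false else false) ≡ false
      both true  = refl
      both false = refl
      none : count (λ a → if member a u then false else false) (range1 n) ≡ 0
      none = trans (count-cong (range1 n) (λ {a} _ → both (member a u))) (count-false (range1 n))

  -- An upper bound suffices: the graphs below supply n! distinct permutations.
  length-perms-≤ : ∀ n → length (perms n) ≤ n !
  length-perms-≤ n = subst (_≤ n !)
    (trans (cong (λ k → count distinct (words n n) * k !) (ℕ.n∸n≡0 n)) (ℕ.*-identityʳ _))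
    (falling n ℕ.≤-refl)
    where
    open ℕ.≤-Reasoning
    falling : ∀ k → k ≤ n → count distinct (words n k) * (n ∸ k) ! ≤ n !
    falling zero    _   = ℕ.≤-reflexive (ℕ.*-identityˡ (n !))
    falling (suc k) k<n = begin
      count distinct (words n (suc k)) * (n ∸ suc k) !
        ≤⟨ ℕ.*-monoˡ-≤ ((n ∸ suc k) !) (count-distinct-suc n k) ⟩
      (n ∸ k) * count distinct (words n k) * (n ∸ suc k) !
        ≡⟨ cong (λ m → m * count distinct (words n k) * (n ∸ suc k) !) (ℕ.+-∸-assoc 1 k<n) ⟩
      suc (n ∸ suc k) * count distinct (words n k) * (n ∸ suc k) !
        ≡⟨ shuffle (suc (n ∸ suc k)) (count distinct (words n k)) ((n ∸ suc k) !) ⟩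
      count distinct (words n k) * (suc (n ∸ suc k) !)
        ≡⟨ cong (λ m → count distinct (words n k) * m !) (ℕ.+-∸-assoc 1 k<n) ⟨
      count distinct (words n k) * (n ∸ k) !
        ≤⟨ falling k (ℕ.<⇒≤ k<n) ⟩
      n ! ∎
      where
      shuffle : ∀ a b c → a * b * c ≡ b * (a * c)
      shuffle = solve-∀

  -- Graphs of permutations in the order of `flatten`.

  Sorted : List ℕ → Set
  Sorted = AllPairs _<_

  sorted-unique : ∀ {xs} → Sorted xs → Unique xs
  sorted-unique = AllPairs.map ℕ.<⇒≢

  ∈-interval⁻ : ∀ x n {y} → y ∈ interval x n → ∃ λ k → k < n × y ≡ x + k
  ∈-interval⁻ x (suc n) (here refl) = 0 , s≤s z≤n , sym (ℕ.+-identityʳ x)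
  ∈-interval⁻ x (suc n) (there y∈) with ∈-interval⁻ (suc x) n y∈
  ... | k , k<n , refl = suc k , s≤s k<n , sym (ℕ.+-suc x k)

  interval-sorted : ∀ x n → Sorted (interval x n)
  interval-sorted x zero    = []
  interval-sorted x (suc n) = All.tabulate above ∷ interval-sorted (suc x) n
    where
    above : ∀ {y} → y ∈ interval (suc x) n → x < y
    above y∈ with ∈-interval⁻ (suc x) n y∈
    ... | k , _ , refl = s≤s (ℕ.m≤m+n x k)

  apply-map-interval : ∀ (f : ℕ → ℕ) x n {k} → k < n → apply (map f (interval x n)) (suc k) ≡ f (x + k)
  apply-map-interval f x (suc n) {zero}  _         = cong f (sym (ℕ.+-identityʳ x))
  apply-map-interval f x (suc n) {suc k} (s≤s k<n) =
    trans (apply-map-interval f (suc x) n k<n) (cong f (sym (ℕ.+-suc x k)))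

  picks : List ℕ → List (ℕ × List ℕ)
  picks []       = []
  picks (x ∷ xs) = (x , xs) ∷ map (λ (b , R) → b , x ∷ R) (picks xs)

  map-proj₁-picks : ∀ R → map proj₁ (picks R) ≡ R
  map-proj₁-picks []       = refl
  map-proj₁-picks (x ∷ xs) = cong (x ∷_) (trans (sym (map-∘ (picks xs))) (map-proj₁-picks xs))

  picks-↭ : ∀ {R b R′} → (b , R′) ∈ picks R → R ↭ b ∷ R′
  picks-↭ {x ∷ xs} (here refl) = ↭.refl
  picks-↭ {x ∷ xs} (there p∈) with ∈-map⁻ (λ (b , R) → b , x ∷ R) p∈
  ... | (b , R) , q∈ , refl = ↭-trans (↭.prep x (picks-↭ q∈)) (↭.swap x b ↭.refl)

  picks-length : ∀ {R b R′ m} → (b , R′) ∈ picks R → length R ≡ suc m → length R′ ≡ m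
  picks-length p∈ len = ℕ.suc-injective (trans (sym (↭.↭-length (picks-↭ p∈))) len)

  picks-sorted : ∀ {R b R′} → Sorted R → (b , R′) ∈ picks R → Sorted R′
  picks-sorted {x ∷ xs} (x< ∷ s) (here refl) = s
  picks-sorted {x ∷ xs} (x< ∷ s) (there p∈) with ∈-map⁻ (λ (b , R) → b , x ∷ R) p∈
  ... | (b , R) , q∈ , refl with ↭.All-resp-↭ (picks-↭ q∈) x<
  ... | _ ∷ x<R = x<R ∷ picks-sorted s q∈

  -- The graph of a permutation, its edges (x , σ x) listed in the order of Flatten.
  Graph : Set
  Graph = List (ℕ × ℕ)

  word : Graph → List ℕ
  word = map proj₁

  -- gen (length R) h a R lists the possible remainders of such a graph when the cycle starting
  -- with h has been followed up to the letter a and R is the list of unused letters.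
  gen : ℕ → ℕ → ℕ → List ℕ → List Graph
  gen zero    h a R       = ((a , h) ∷ []) ∷ []
  gen (suc m) h a []      = []
  gen (suc m) h a (x ∷ R) =
    map ((a , h) ∷_) (gen m x x R) ++
    concatMap (λ (b , R′) → map ((a , b) ∷_) (gen m h b R′)) (picks (x ∷ R))

  data Trace : ℕ → ℕ → List ℕ → Graph → Set where
    end  : ∀ {h a} → Trace h a [] ((a , h) ∷ [])
    new  : ∀ {h a x R l} → Trace x x R l → Trace h a (x ∷ R) ((a , h) ∷ l)
    step : ∀ {h a b R R′ l} → (b , R′) ∈ picks R → Trace h b R′ l → Trace h a R ((a , b) ∷ l)

  gen-trace : ∀ m {h a R l} → length R ≡ m → l ∈ gen m h a R → Trace h a R l
  gen-trace zero    {R = []} len (here refl) = end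
  gen-trace (suc m) {h} {a} {x ∷ R} len l∈ with ∈-++⁻ (map ((a , h) ∷_) (gen m x x R)) l∈
  ... | inj₁ l∈new with ∈-map⁻ ((a , h) ∷_) l∈new
  ...   | _ , l′∈ , refl = new (gen-trace m (ℕ.suc-injective len) l′∈)
  gen-trace (suc m) {h} {a} {x ∷ R} len l∈ | inj₂ l∈step
    with find (∈-concatMap⁻ (λ (b , R′) → map ((a , b) ∷_) (gen m h b R′)) {xs = picks (x ∷ R)} l∈step)
  ... | (b , R′) , p∈ , l∈map with ∈-map⁻ ((a , b) ∷_) l∈map
  ...   | _ , l′∈ , refl = step p∈ (gen-trace m (picks-length p∈ len) l′∈)

  word-↭ : ∀ {h a R l} → Trace h a R l → word l ↭ a ∷ R
  word-↭ end             = ↭.refl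
  word-↭ (new t)         = ↭.prep _ (word-↭ t)
  word-↭ (step p∈ t)     = ↭.prep _ (↭-trans (word-↭ t) (↭-sym (picks-↭ p∈)))

  values-↭ : ∀ {h a R l} → Trace h a R l → map proj₂ l ↭ h ∷ R
  values-↭ end         = ↭.refl
  values-↭ (new t)     = ↭.prep _ (values-↭ t)
  values-↭ (step {h} {b = b} p∈ t) =
    ↭-trans (↭.prep b (values-↭ t)) (↭-trans (↭.swap b h ↭.refl) (↭.prep h (↭-sym (picks-↭ p∈))))

  -- With m + 1 letters left there is one way to close the cycle and m + 1 ways to continue it,
  -- hence (m + 2) (m + 1)! graphs.
  length-gen : ∀ m {h a R} → length R ≡ m → length (gen m h a R) ≡ suc m !
  length-gen zero    len = refl
  length-gen (suc m) {h} {a} {x ∷ R} len = begin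
    length (map ((a , h) ∷_) (gen m x x R) ++ concatMap extend (picks (x ∷ R)))
      ≡⟨ length-++ (map ((a , h) ∷_) (gen m x x R)) ⟩
    length (map ((a , h) ∷_) (gen m x x R)) + length (concatMap extend (picks (x ∷ R)))
      ≡⟨ cong₂ _+_ (trans (length-map _ (gen m x x R)) (length-gen m (ℕ.suc-injective len)))
                   (blocks (picks (x ∷ R)) (λ p∈ → p∈)) ⟩
    suc m ! + length (picks (x ∷ R)) * suc m !
      ≡⟨ cong (λ n → suc m ! + n * suc m !) (trans (sym (length-map proj₁ (picks (x ∷ R))))
                                               (trans (cong length (map-proj₁-picks (x ∷ R))) len)) ⟩
    suc m ! + suc m * suc m ! ∎
    where
    open ≡-Reasoning
    extend : ℕ × List ℕ → List Graph
    extend (b , R′) = map ((a , b) ∷_) (gen m h b R′)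
    blocks : ∀ ps → ps ⊆ picks (x ∷ R) → length (concatMap extend ps) ≡ length ps * suc m !
    blocks []              _   = refl
    blocks ((b , R′) ∷ ps) ps⊆ = trans (length-++ (extend (b , R′)))
      (cong₂ _+_ (trans (length-map _ (gen m h b R′)) (length-gen m (picks-length (ps⊆ (here refl)) len)))
                 (blocks ps (ps⊆ ∘ there)))

  gen-unique : ∀ m {h a R} → length R ≡ m → Sorted R → h ∉ R → Unique (gen m h a R)
  gen-unique zero    len s h∉ = [] ∷ []
  gen-unique (suc m) {h} {a} {x ∷ R} len (x< ∷ s) h∉ = Unique.++⁺
    (Unique.map⁺ ∷-injectiveʳ
      (gen-unique m (ℕ.suc-injective len) s (λ x∈ → ℕ.<-irrefl refl (All.lookup x< x∈))))
    (Unique.concat⁺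
      (All.map⁺ (All.tabulate λ { {b , R′} p∈ → Unique.map⁺ ∷-injectiveʳ
        (gen-unique m (picks-length p∈ len) (picks-sorted (x< ∷ s) p∈)
          (λ h∈ → h∉ (↭.∈-resp-↭ (↭-sym (picks-↭ p∈)) (there h∈)))) }))
      (AllPairs.map⁺ (AllPairs.map apart
        (AllPairs.map⁻ (subst Unique (sym (map-proj₁-picks (x ∷ R))) (sorted-unique (x< ∷ s)))))))
    (λ (l∈new , l∈step) → new-step l∈new l∈step)
    where
    extend : ℕ × List ℕ → List Graph
    extend (b , R′) = map ((a , b) ∷_) (gen m h b R′)
    apart : ∀ {p q} → proj₁ p ≢ proj₁ q → ∀ {l} → l ∈ extend p × l ∈ extend q → ⊥
    apart {b , _} {c , _} b≢c (l∈b , l∈c) with ∈-map⁻ ((a , b) ∷_) l∈b | ∈-map⁻ ((a , c) ∷_) l∈c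
    ... | _ , _ , refl | _ , _ , eq = b≢c (cong proj₂ (∷-injectiveˡ eq))
    new-step : ∀ {l} → l ∈ map ((a , h) ∷_) (gen m x x R) → l ∈ concatMap extend (picks (x ∷ R)) → ⊥
    new-step l∈new l∈step with ∈-map⁻ ((a , h) ∷_) l∈new
                             | find (∈-concatMap⁻ extend {xs = picks (x ∷ R)} l∈step)
    ... | _ , _ , refl | (b , R′) , p∈ , l∈b with ∈-map⁻ ((a , b) ∷_) l∈b
    ...   | _ , _ , eq = h∉ (subst (_∈ x ∷ R) (sym (cong proj₂ (∷-injectiveˡ eq)))
                               (↭.∈-resp-↭ (↭-sym (picks-↭ p∈)) (here refl)))

  -- `flatten` of a permutation with a given graph.

  Agrees : List ℕ → Graph → Set
  Agrees w = All (λ (x , y) → apply w x ≡ y)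

  -- The letters of the current cycle that follow a.
  cycleRest : ∀ {h a R l} → Trace h a R l → List ℕ
  cycleRest end                = []
  cycleRest (new t)            = []
  cycleRest (step {b = b} _ t) = b ∷ cycleRest t

  heads : ∀ {h a R l} → Trace h a R l → List ℕ
  heads end             = []
  heads (new {x = x} t) = x ∷ heads t
  heads (step _ t)      = heads t

  cycleRest-⊆ : ∀ {h a R l} (t : Trace h a R l) → cycleRest t ⊆ R
  cycleRest-⊆ (step p∈ t) (here refl) = ↭.∈-resp-↭ (↭-sym (picks-↭ p∈)) (here refl)
  cycleRest-⊆ (step p∈ t) (there y∈)  = ↭.∈-resp-↭ (↭-sym (picks-↭ p∈)) (there (cycleRest-⊆ t y∈))

  heads-⊆ : ∀ {h a R l} (t : Trace h a R l) → heads t ⊆ R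
  heads-⊆ (new t)     (here refl) = here refl
  heads-⊆ (new t)     (there y∈)  = there (heads-⊆ t y∈)
  heads-⊆ (step p∈ t) y∈          = ↭.∈-resp-↭ (↭-sym (picks-↭ p∈)) (there (heads-⊆ t y∈))

  heads-sorted : ∀ {h a R l} (t : Trace h a R l) → Sorted R → Sorted (heads t)
  heads-sorted end         s        = []
  heads-sorted (new t)     (x< ∷ s) = All.tabulate (λ y∈ → All.lookup x< (heads-⊆ t y∈)) ∷ heads-sorted t s
  heads-sorted (step p∈ t) s        = heads-sorted t (picks-sorted s p∈)

  -- By `h ∉ R` the orbit can stop only at the closing edge, and the fuel lasts because each step
  -- uses up a letter of R.
  orbit-cycle : ∀ {w h a R l} (t : Trace h a R l) → Agrees w l → h ∉ R → ∀ f → length R ≤ f →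
                orbit w h f (apply w a) ≡ cycleRest t
  orbit-cycle {h = h} end     (eq ∷ _) h∉ zero    _ = refl
  orbit-cycle {h = h} end     (eq ∷ _) h∉ (suc f) _ rewrite eq | ≡ᵇ-true h = refl
  orbit-cycle {h = h} (new t) (eq ∷ _) h∉ zero    _ = refl
  orbit-cycle {h = h} (new t) (eq ∷ _) h∉ (suc f) _ rewrite eq | ≡ᵇ-true h = refl
  orbit-cycle {h = h} {R = R} (step {b = b} p∈ t) (eq ∷ ag) h∉ zero R≤ =
    contradiction (subst (_≤ 0) (↭.↭-length (picks-↭ p∈)) R≤) λ ()
  orbit-cycle {h = h} {R = R} (step {b = b} p∈ t) (eq ∷ ag) h∉ (suc f) R≤
    rewrite eq | ≡ᵇ-false {b} {h} (λ { refl → h∉ (↭.∈-resp-↭ (↭-sym (picks-↭ p∈)) (here refl)) }) =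
    cong (b ∷_) (orbit-cycle t ag (λ h∈ → h∉ (↭.∈-resp-↭ (↭-sym (picks-↭ p∈)) (there h∈))) f
      (ℕ.≤-pred (subst (_≤ suc f) (↭.↭-length (picks-↭ p∈)) R≤)))

  -- Used when m is a later letter of the cycle of h: the orbit of m then runs through the smaller
  -- letter h, so m starts no cycle in standard form.
  head∈orbit : ∀ {w m h a R l} → Trace h a R l → Agrees w l → m ≢ h → m ∉ R → ∀ f → length R < f →
               h ∈ orbit w m f (apply w a)
  head∈orbit {m = m} {h} end     (eq ∷ _) m≢h m∉ (suc f) _ rewrite eq | ≡ᵇ-false (m≢h ∘ sym) = here refl
  head∈orbit {m = m} {h} (new t) (eq ∷ _) m≢h m∉ (suc f) _ rewrite eq | ≡ᵇ-false (m≢h ∘ sym) = here refl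
  head∈orbit {m = m} (step {b = b} p∈ t) (eq ∷ ag) m≢h m∉ (suc f) R<
    rewrite eq | ≡ᵇ-false {b} {m} (λ { refl → m∉ (↭.∈-resp-↭ (↭-sym (picks-↭ p∈)) (here refl)) }) =
    there (head∈orbit t ag m≢h (λ m∈ → m∉ (↭.∈-resp-↭ (↭-sym (picks-↭ p∈)) (there m∈))) f
      (ℕ.≤-pred (subst (_< suc f) (↭.↭-length (picks-↭ p∈)) R<)))

  ≤ᵇ-true : ∀ {m n} → m ≤ n → (m ≤ᵇ n) ≡ true
  ≤ᵇ-true {m} {n} m≤n with m ≤ᵇ n | ℕ.≤⇒≤ᵇ m≤n
  ... | true | _ = refl

  ≤ᵇ-false : ∀ {m n} → n < m → (m ≤ᵇ n) ≡ false
  ≤ᵇ-false {m} {n} n<m with m ≤ᵇ n in eq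
  ... | true  = contradiction (ℕ.≤ᵇ⇒≤ m n (subst Bool.T (sym eq) tt)) (ℕ.<⇒≱ n<m)
  ... | false = refl

  all≥-true : ∀ {m xs} → All (m ≤_) xs → all≥ m xs ≡ true
  all≥-true []          = refl
  all≥-true (m≤x ∷ m≤s) rewrite ≤ᵇ-true m≤x = all≥-true m≤s

  all≥-false : ∀ {m x xs} → x ∈ xs → x < m → all≥ m xs ≡ false
  all≥-false {m} (here refl) x<m rewrite ≤ᵇ-false x<m = refl
  all≥-false {m} {xs = y ∷ xs} (there x∈) x<m with m ≤ᵇ y
  ... | true  = all≥-false x∈ x<m
  ... | false = refl

  block : List ℕ → ℕ → List ℕ
  block w m = if isCycleMin w m then cycleOf w m else []

  module _ {w : List ℕ} where

    block-head : ∀ {h R l} (t : Trace h h R l) → Agrees w l → All (h <_) R → length R ≤ length w →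
                 block w h ≡ h ∷ cycleRest t
    block-head {h} t ag h< R≤ = trans (cong (if_then cycleOf w h else []) minimal) cycle
      where
      cycle : cycleOf w h ≡ h ∷ cycleRest t
      cycle = trans (cycleOf-orbit w h)
        (cong (h ∷_) (orbit-cycle t ag (λ h∈ → ℕ.<-irrefl refl (All.lookup h< h∈)) (length w) R≤))
      minimal : isCycleMin w h ≡ true
      minimal = trans (isCycleMin-all≥ w h) (trans (cong (all≥ h) cycle)
        (all≥-true (ℕ.≤-refl ∷ All.tabulate (λ y∈ → ℕ.<⇒≤ (All.lookup h< (cycleRest-⊆ t y∈))))))

    block-nonhead : ∀ {h b R l} → Trace h b R l → Agrees w l → h < b → b ∉ R → length R < length w →
                    block w b ≡ []
    block-nonhead {h} {b} t ag h<b b∉ R< = cong (if_then cycleOf w b else [])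
      (trans (isCycleMin-all≥ w b) (trans (cong (all≥ b) (cycleOf-orbit w b))
        (all≥-false (there (head∈orbit t ag (ℕ.<⇒≢ h<b ∘ sym) b∉ (length w) R<)) h<b)))

    heads-or-[] : ∀ {h a R l} (t : Trace h a R l) → Agrees w l → Sorted R → All (h <_) R →
                  length R ≤ length w → ∀ {y} → y ∈ R → y ∈ heads t ⊎ block w y ≡ []
    heads-or-[] (new t) ag s h< R≤ (here refl) = inj₁ (here refl)
    heads-or-[] (new t) (_ ∷ ag) (x< ∷ s) h< R≤ (there y∈) =
      Sum.map₁ there (heads-or-[] t ag s x< (ℕ.<⇒≤ R≤) y∈)
    heads-or-[] {R = R} (step {b = b} {R′ = R′} p∈ t) (_ ∷ ag) s h< R≤ y∈
      with ↭.∈-resp-↭ (picks-↭ p∈) y∈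
         | ↭.All-resp-↭ (picks-↭ p∈) h<
         | subst (_≤ length w) (↭.↭-length (picks-↭ p∈)) R≤
         | Setoid↭.Unique-resp-↭ (setoid ℕ) (↭⇒↭ₛ (picks-↭ p∈)) (sorted-unique s)
    ... | here refl | h<b ∷ _  | R′< | b∉ ∷ _ = inj₂ (block-nonhead t ag h<b (λ b∈ → All.lookup b∉ b∈ refl) R′<)
    ... | there y∈′ | _ ∷ h<R′ | R′< | _      = heads-or-[] t ag (picks-sorted s p∈) h<R′ (ℕ.<⇒≤ R′<) y∈′

    word-blocks : ∀ {h a R l} (t : Trace h a R l) → Agrees w l → Sorted R →
                  length R ≤ length w → word l ≡ a ∷ cycleRest t ++ concatMap (block w) (heads t)
    word-blocks end ag s R≤ = refl
    word-blocks (new {h} {a} {x = x} t) (_ ∷ ag) (x< ∷ s) R≤ = cong (a ∷_)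
      (trans (word-blocks t ag s (ℕ.<⇒≤ R≤))
             (cong (_++ concatMap (block w) (heads t)) (sym (block-head t ag x< (ℕ.<⇒≤ R≤)))))
    word-blocks (step p∈ t) (_ ∷ ag) s R≤ = cong (_ ∷_)
      (word-blocks t ag (picks-sorted s p∈) (ℕ.<⇒≤ (subst (_≤ length w) (↭.↭-length (picks-↭ p∈)) R≤)))

  -- `flatten` runs over all letters but a trace records only the heads. Both lists are increasing,
  -- so the nonempty blocks come in the same order.
  concatMap-sublist : ∀ (F : ℕ → List ℕ) xs H → Sorted xs → Sorted H → H ⊆ xs →
                      (∀ {y} → y ∈ xs → y ∈ H ⊎ F y ≡ []) → concatMap F xs ≡ concatMap F H
  concatMap-sublist F []       []      _ _ _  _ = refl
  concatMap-sublist F []       (z ∷ H) _ _ H⊆ _ = case H⊆ (here refl) of λ ()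
  concatMap-sublist F (x ∷ xs) []      (x< ∷ s) _ _ dec with dec (here refl)
  ... | inj₂ Fx≡[] rewrite Fx≡[] = concatMap-sublist F xs [] s [] (λ ()) (dec ∘ there)
  concatMap-sublist F (x ∷ xs) (z ∷ H) (x< ∷ s) (z< ∷ sH) H⊆ dec with H⊆ (here refl)
  ... | here refl = cong (F x ++_) (concatMap-sublist F xs H s sH
          (λ y∈ → case H⊆ (there y∈) of λ
             { (here refl)  → contradiction refl (ℕ.<⇒≢ (All.lookup z< y∈))
             ; (there y∈xs) → y∈xs })
          (λ y∈ → case dec (there y∈) of λ
             { (inj₁ (here refl))  → contradiction refl (ℕ.<⇒≢ (All.lookup x< y∈))
             ; (inj₁ (there y∈H)) → inj₁ y∈H
             ; (inj₂ Fy≡[])        → inj₂ Fy≡[] }))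
  ... | there z∈ with dec (here refl)
  ...   | inj₁ (here refl) = contradiction refl (ℕ.<⇒≢ (All.lookup x< z∈))
  ...   | inj₁ (there x∈H) = contradiction (ℕ.<-trans (All.lookup x< z∈) (All.lookup z< x∈H)) (ℕ.<-irrefl refl)
  ...   | inj₂ Fx≡[] rewrite Fx≡[] = concatMap-sublist F xs (z ∷ H) s (z< ∷ sH)
            (λ { (here refl) → z∈ ; (there y∈) → case H⊆ (there y∈) of λ
               { (here refl) → contradiction (ℕ.<-trans (All.lookup x< z∈) (All.lookup z< y∈)) (ℕ.<-irrefl refl)
               ; (there y∈xs) → y∈xs } })
            (dec ∘ there)

  -- Permutations correspond to graphs.

  value : Graph → ℕ → ℕ
  value []            x = 0
  value ((y , z) ∷ l) x = if x ≡ᵇ y then z else value l x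

  decode : ℕ → Graph → List ℕ
  decode n l = map (value l) (interval 1 n)

  value-edges : ∀ l → Unique (word l) → All (λ (x , y) → value l x ≡ y) l
  value-edges []            _         = []
  value-edges ((x , y) ∷ l) (x∉ ∷ l!) =
    cong (if_then y else value l x) (≡ᵇ-true x) ∷ All.tabulate λ {p} p∈ →
      trans (cong (if_then y else value l (proj₁ p))
                  (≡ᵇ-false (All.lookup x∉ (∈-map⁺ proj₁ p∈) ∘ sym)))
            (All.lookup (value-edges l l!) p∈)

  module _ {m : ℕ} {l : Graph} (t : Trace 1 1 (interval 2 m) l) where
    private
      n = suc m
      w = decode n l

      letters! : Unique (word l)
      letters! = Setoid↭.Unique-resp-↭ (setoid ℕ) (↭⇒↭ₛ (↭-sym (word-↭ t)))
                   (sorted-unique (interval-sorted 1 n))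

      length-w : length w ≡ n
      length-w = trans (length-map (value l) (interval 1 n)) (length-interval 1 n)

      w-↭ : w ↭ interval 1 n
      w-↭ = ↭-trans (↭.map⁺ (value l) (↭-sym (word-↭ t)))
              (subst (_↭ interval 1 n) (sym values) (values-↭ t))
        where
        values : map (value l) (word l) ≡ map proj₂ l
        values = trans (sym (map-∘ l)) (map-cong-local (value-edges l letters!))

    decode-agrees : Agrees (decode n l) l
    decode-agrees = All.tabulate λ {p} p∈ →
      trans (at (↭.∈-resp-↭ (word-↭ t) (∈-map⁺ proj₁ p∈))) (All.lookup (value-edges l letters!) p∈)
      where
      at : ∀ {x} → x ∈ interval 1 n → apply w x ≡ value l x
      at x∈ with ∈-interval⁻ 1 n x∈
      ... | k , k<n , refl = apply-map-interval (value l) 1 n k<n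

    decode∈perms : decode n l ∈ perms n
    decode∈perms = ∈-perms⁺
      (λ x∈ → subst (_ ∈_) (sym (range1-interval n)) (↭.∈-resp-↭ w-↭ x∈))
      length-w
      (Setoid↭.Unique-resp-↭ (setoid ℕ) (↭⇒↭ₛ (↭-sym w-↭)) (sorted-unique (interval-sorted 1 n)))

    flatten-decode : flatten (decode n l) ≡ word l
    flatten-decode = begin
      concatMap (block w) (range1 (length w))
        ≡⟨ cong (concatMap (block w)) (trans (cong range1 length-w) (range1-interval n)) ⟩
      concatMap (block w) (1 ∷ interval 2 m)
        ≡⟨ concatMap-sublist (block w) (1 ∷ interval 2 m) (1 ∷ heads t)
             sorted (All.tabulate (λ y∈ → All.lookup 1< (heads-⊆ t y∈)) ∷ heads-sorted t (AllPairs.tail sorted))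
             (λ { (here refl) → here refl ; (there y∈) → there (heads-⊆ t y∈) })
             (λ { (here refl) → inj₁ (here refl)
                ; (there y∈) → Sum.map₁ there (heads-or-[] t decode-agrees (AllPairs.tail sorted) 1< fits y∈) }) ⟩
      concatMap (block w) (1 ∷ heads t)
        ≡⟨ cong (_++ concatMap (block w) (heads t)) (block-head t decode-agrees 1< fits) ⟩
      1 ∷ cycleRest t ++ concatMap (block w) (heads t)
        ≡⟨ word-blocks t decode-agrees (AllPairs.tail sorted) fits ⟨
      word l ∎
      where
      open ≡-Reasoning
      sorted : Sorted (interval 1 n)
      sorted = interval-sorted 1 n
      1< : All (1 <_) (interval 2 m)
      1< = AllPairs.head sorted
      fits : length (interval 2 m) ≤ length w
      fits = subst₂ _≤_ (sym (length-interval 2 m)) (sym length-w) (ℕ.n≤1+n m)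

    -- `flatten` returns the sources of the edges in order and `apply` their targets, so `decode`
    -- has a left inverse on graphs with a trace.
    encode-decode : map (λ x → x , apply (decode n l) x) (flatten (decode n l)) ≡ l
    encode-decode = trans (cong (map _) flatten-decode) (trans (sym (map-∘ l))
      (trans (map-cong-local (All.map (cong (_ ,_)) decode-agrees)) (map-id l)))

  graphs : ℕ → List Graph
  graphs m = gen m 1 1 (interval 2 m)

  graphs-trace : ∀ m {l} → l ∈ graphs m → Trace 1 1 (interval 2 m) l
  graphs-trace m = gen-trace m (length-interval 2 m)

  perms-↭ : ∀ m → perms (suc m) ↭ map (decode (suc m)) (graphs m)
  perms-↭ m = unique-⊆-≥-↭ unique included
    (ℕ.≤-trans (length-perms-≤ (suc m))
               (ℕ.≤-reflexive (sym (trans (length-map _ (graphs m)) (length-gen m (length-interval 2 m))))))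
    where
    n = suc m
    encode : List ℕ → Graph
    encode w = map (λ x → x , apply w x) (flatten w)
    unique : Unique (map (decode n) (graphs m))
    unique = Unique.map⁻ {f = encode} (subst Unique
      (sym (trans (sym (map-∘ (graphs m)))
        (trans (map-cong-local (All.tabulate (λ l∈ → encode-decode (graphs-trace m l∈)))) (map-id (graphs m)))))
      (gen-unique m (length-interval 2 m) (AllPairs.tail (interval-sorted 1 n))
        (λ 1∈ → ℕ.<-irrefl refl (All.lookup (AllPairs.head (interval-sorted 1 n)) 1∈))))
    included : map (decode n) (graphs m) ⊆ perms n
    included w∈ with ∈-map⁻ (decode n) w∈
    ... | l , l∈ , refl = decode∈perms (graphs-trace m l∈)

  count-flatten : ∀ (p : List ℕ → Bool) m → count (p ∘ flatten) (perms (suc m)) ≡ count (p ∘ word) (graphs m)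
  count-flatten p m = begin
    count (p ∘ flatten) (perms (suc m))
      ≡⟨ count-↭ (p ∘ flatten) (perms-↭ m) ⟩
    count (p ∘ flatten) (map (decode (suc m)) (graphs m))
      ≡⟨ count-map (p ∘ flatten) (decode (suc m)) (graphs m) ⟩
    count (p ∘ flatten ∘ decode (suc m)) (graphs m)
      ≡⟨ count-cong (graphs m) (λ l∈ → cong p (flatten-decode (graphs-trace m l∈))) ⟩
    count (p ∘ word) (graphs m) ∎
    where open ≡-Reasoning

  -- Ranks, occurrences of 13-2, and the formula for `g`.

  <ᵇ-true : ∀ {m n} → m < n → (m <ᵇ n) ≡ true
  <ᵇ-true {m} {n} m<n with m <ᵇ n | ℕ.<⇒<ᵇ m<n
  ... | true | _ = refl

  <ᵇ-false : ∀ {m n} → n ≤ m → (m <ᵇ n) ≡ false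
  <ᵇ-false {m} {n} n≤m with m <ᵇ n in eq
  ... | true  = contradiction (ℕ.<ᵇ⇒< m n (subst Bool.T (sym eq) tt)) (ℕ.≤⇒≯ n≤m)
  ... | false = refl

  below : ℕ → List ℕ → ℕ
  below a = count (_<ᵇ a)

  below-minimum : ∀ {x xs} → All (x <_) xs → below x xs ≡ 0
  below-minimum {xs = xs} x< =
    trans (count-cong xs (λ y∈ → <ᵇ-false (ℕ.<⇒≤ (All.lookup x< y∈)))) (count-false xs)

  countBetween-count : ∀ a b xs → countBetween a b xs ≡ count (λ c → (a <ᵇ c) ∧ (c <ᵇ b)) xs
  countBetween-count a b []       = refl
  countBetween-count a b (c ∷ xs) with (a <ᵇ c) ∧ (c <ᵇ b)
  ... | true  = cong suc (countBetween-count a b xs)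
  ... | false = countBetween-count a b xs

  countBetween-↭ : ∀ a b {xs ys} → xs ↭ ys → countBetween a b xs ≡ countBetween a b ys
  countBetween-↭ a b {xs} {ys} xs↭ys = trans (countBetween-count a b xs)
    (trans (count-↭ _ xs↭ys) (sym (countBetween-count a b ys)))

  below-mono : ∀ {a b} → a ≤ b → ∀ xs → below a xs ≤ below b xs
  below-mono a≤b [] = z≤n
  below-mono {a} {b} a≤b (c ∷ xs) with ℕ.<-≤-connex c a
  ... | inj₁ c<a rewrite <ᵇ-true c<a | <ᵇ-true (ℕ.<-≤-trans c<a a≤b) = s≤s (below-mono a≤b xs)
  ... | inj₂ a≤c rewrite <ᵇ-false a≤c with c <ᵇ b
  ...   | true  = ℕ.m≤n⇒m≤1+n (below-mono a≤b xs)
  ...   | false = below-mono a≤b xs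

  below-+-countBetween : ∀ {a b} → a ≤ b → ∀ xs → All (a ≢_) xs →
                         below a xs + countBetween a b xs ≡ below b xs
  below-+-countBetween a≤b [] _ = refl
  below-+-countBetween {a} {b} a≤b (c ∷ xs) (a≢c ∷ a∉) with ℕ.<-≤-connex c a
  ... | inj₁ c<a rewrite <ᵇ-true c<a | <ᵇ-true (ℕ.<-≤-trans c<a a≤b) | <ᵇ-false (ℕ.<⇒≤ c<a) =
    cong suc (below-+-countBetween a≤b xs a∉)
  ... | inj₂ a≤c rewrite <ᵇ-false a≤c | <ᵇ-true (ℕ.≤∧≢⇒< a≤c a≢c) with c <ᵇ b
  ...   | true  = trans (ℕ.+-suc _ _) (cong suc (below-+-countBetween a≤b xs a∉))
  ...   | false = below-+-countBetween a≤b xs a∉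

  countBetween-≥ : ∀ {a b} → b ≤ a → ∀ xs → countBetween a b xs ≡ 0
  countBetween-≥ b≤a [] = refl
  countBetween-≥ {a} {b} b≤a (c ∷ xs) with ℕ.<-≤-connex c b
  ... | inj₁ c<b rewrite <ᵇ-false (ℕ.<⇒≤ (ℕ.<-≤-trans c<b b≤a)) = countBetween-≥ b≤a xs
  ... | inj₂ b≤c rewrite <ᵇ-false b≤c with a <ᵇ c
  ...   | true  = countBetween-≥ b≤a xs
  ...   | false = countBetween-≥ b≤a xs

  -- Truncated subtraction covers both cases. For a descent, everything below b is also below a and
  -- both sides are 0; for an ascent, b itself is not below a and the ranks differ by the letters in
  -- between.
  countBetween-below : ∀ {a b xs} → All (a ≢_) (b ∷ xs) →
                       countBetween a b xs ≡ below b xs ∸ below a (b ∷ xs)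
  countBetween-below {a} {b} {xs} (_ ∷ a∉) with ℕ.<-≤-connex b a
  ... | inj₁ b<a rewrite <ᵇ-true b<a = trans (countBetween-≥ (ℕ.<⇒≤ b<a) xs)
    (sym (ℕ.m≤n⇒m∸n≡0 (ℕ.m≤n⇒m≤1+n (below-mono (ℕ.<⇒≤ b<a) xs))))
  ... | inj₂ a≤b rewrite <ᵇ-false a≤b =
    sym (trans (cong (_∸ below a xs) (sym (below-+-countBetween a≤b xs a∉)))
               (ℕ.m+n∸m≡n (below a xs) (countBetween a b xs)))

  -- In a sorted list, the k-th element has k smaller ones.
  sum-picks : ∀ (φ : ℕ → ℕ → ℕ) R → Sorted R →
    sum (map (λ (b , R′) → φ b (below b R′)) (picks R)) ≡ ∑ (length R) (λ k → φ (apply R (suc k)) k)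
  sum-picks φ []       _        = refl
  sum-picks φ (x ∷ xs) (x< ∷ s) = cong₂ _+_ (cong (φ x) (below-minimum x<)) (trans
    (cong sum (trans (sym (map-∘ (picks xs))) (map-cong-local (All.tabulate shifted))))
    (sum-picks (λ b k → φ b (suc k)) xs s))
    where
    shifted : ∀ {p} → p ∈ picks xs → φ (proj₁ p) (below (proj₁ p) (x ∷ proj₂ p))
                                   ≡ φ (proj₁ p) (suc (below (proj₁ p) (proj₂ p)))
    shifted {b , R} p∈ rewrite <ᵇ-true (All.lookup x< (↭.∈-resp-↭ (↭-sym (picks-↭ p∈)) (here refl))) = refl

  -- The letters after b form a rearrangement of R, and `countBetween` ignores order. The case split
  -- only exposes b as the first letter of `word l`.
  occ-cons : ∀ {a h b R l} → Trace h b R l → occ13-2 (a ∷ word l) ≡ countBetween a b R + occ13-2 (word l)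
  occ-cons {a} {b = b} {l = l} t@end = cong (_+ occ13-2 (word l)) (countBetween-↭ a b (↭.drop-∷ (word-↭ t)))
  occ-cons {a} {b = b} {l = l} t@(new _) = cong (_+ occ13-2 (word l)) (countBetween-↭ a b (↭.drop-∷ (word-↭ t)))
  occ-cons {a} {b = b} {l = l} t@(step _ _) = cong (_+ occ13-2 (word l)) (countBetween-↭ a b (↭.drop-∷ (word-↭ t)))

  count-lag : ∀ (o : A → ℕ) xs s d →
              count (λ x → (d + o x) ≡ᵇ s) xs ≡ lag (λ s → count (λ x → o x ≡ᵇ s) xs) s d
  count-lag o xs s       zero    = refl
  count-lag o xs zero    (suc d) = count-false xs
  count-lag o xs (suc s) (suc d) = count-lag o xs s d

  lag-cong : ∀ {f h : ℕ → ℕ} → f ≗ h → ∀ s d → lag f s d ≡ lag h s d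
  lag-cong f≗h s       zero    = f≗h s
  lag-cong f≗h zero    (suc d) = refl
  lag-cong f≗h (suc s) (suc d) = lag-cong f≗h s d

  lag-* : ∀ c f s d → lag (λ s → c * f s) s d ≡ c * lag f s d
  lag-* c f s       zero    = refl
  lag-* c f zero    (suc d) = sym (ℕ.*-zeroʳ c)
  lag-* c f (suc s) (suc d) = lag-* c f s d

  -- Twice U m j s without the factor for the first letter being a right-to-left minimum.
  T : ℕ → ℕ → ℕ → ℕ
  T zero    j s = U 0 j s
  T (suc m) j s = 2 * Y m j s

  -- The bound `k ≤ m` matters at m = 0: there `T` has no factor 2, and only `ω 0` supplies it.
  ω-T : ∀ m k s → k ≤ m → ω k * T m k s ≡ 2 * U m k s
  ω-T zero    zero s _ = refl
  ω-T (suc m) k    s _ = swap (ω k) 2 (Y m k s)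
    where
    swap : ∀ a b c → a * (b * c) ≡ b * (a * c)
    swap = solve-∀

  ω-lag-T : ∀ m k s d → k ≤ m → ω k * lag (T m k) s d ≡ 2 * lag (U m k) s d
  ω-lag-T m k s d k≤m = trans (sym (lag-* (ω k) (T m k) s d))
    (trans (lag-cong (λ s → ω-T m k s k≤m) s d) (lag-* 2 (U m k) s d))

  ∑-ω : ∀ n f → f 0 + ∑ (suc n) f ≡ ∑ (suc n) (λ k → ω k * f k)
  ∑-ω n f = trans (sym (ℕ.+-assoc (f 0) (f 0) _))
    (cong₂ _+_ (cong (f 0 +_) (sym (ℕ.+-identityʳ (f 0))))
               (∑-cong n (λ k _ → sym (ℕ.+-identityʳ (f (suc k))))))

  -- The smallest unused letter x can follow a in two ways, closing the current cycle or not.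
  count-gen-suc : ∀ m {h a x R} (p : List ℕ → Bool) (φ : ℕ → ℕ → ℕ) → length R ≡ m → Sorted (x ∷ R) →
    (∀ h {b R′} → (b , R′) ∈ picks (x ∷ R) →
       count (λ l → p (a ∷ word l)) (gen m h b R′) ≡ φ b (below b R′)) →
    count (p ∘ word) (gen (suc m) h a (x ∷ R)) ≡ ∑ (suc m) (λ k → ω k * φ (apply (x ∷ R) (suc k)) k)
  count-gen-suc m {h} {a} {x} {R} p φ len s@(x< ∷ _) count-φ = begin
    count (p ∘ word) (map ((a , h) ∷_) (gen m x x R) ++ concatMap extend (picks (x ∷ R)))
      ≡⟨ count-++ (p ∘ word) (map ((a , h) ∷_) (gen m x x R)) _ ⟩
    count (p ∘ word) (map ((a , h) ∷_) (gen m x x R)) + count (p ∘ word) (concatMap extend (picks (x ∷ R)))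
      ≡⟨ cong₂ _+_ (trans (count-map (p ∘ word) ((a , h) ∷_) (gen m x x R)) (count-φ x (here refl)))
                   (trans (count-concatMap (p ∘ word) extend (picks (x ∷ R)))
                          (cong sum (map-cong-local (All.tabulate count-extend)))) ⟩
    φ x (below x R) + sum (map (λ (b , R′) → φ b (below b R′)) (picks (x ∷ R)))
      ≡⟨ cong₂ _+_ (cong (φ x) (below-minimum x<)) (trans (sum-picks φ (x ∷ R) s) (cong (λ n → ∑ (suc n) ψ) len)) ⟩
    ψ 0 + ∑ (suc m) ψ
      ≡⟨ ∑-ω m ψ ⟩
    ∑ (suc m) (λ k → ω k * ψ k) ∎
    where
    open ≡-Reasoning
    ψ : ℕ → ℕ
    ψ k = φ (apply (x ∷ R) (suc k)) k
    extend : ℕ × List ℕ → List Graph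
    extend (b , R′) = map ((a , b) ∷_) (gen m h b R′)
    count-extend : ∀ {pr} → pr ∈ picks (x ∷ R) →
                   count (p ∘ word) (extend pr) ≡ φ (proj₁ pr) (below (proj₁ pr) (proj₂ pr))
    count-extend {b , R′} p∈ = trans (count-map (p ∘ word) ((a , b) ∷_) (gen m h b R′)) (count-φ h p∈)

  hasOcc : ℕ → List ℕ → Bool
  hasOcc s u = occ13-2 u ≡ᵇ s

  -- The count depends on a and R only through the rank of a and the length of R. The head h affects
  -- only the targets of edges, hence never the word.
  count-gen : ∀ m {h a R} s → length R ≡ m → Sorted R → All (a ≢_) R →
              count (hasOcc s ∘ word) (gen m h a R) ≡ T m (below a R) s

  count-gen-cons : ∀ m {h a b R R′} s → length R′ ≡ m → Sorted R′ → All (a ≢_) R → R ↭ b ∷ R′ → All (b ≢_) R′ →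
    count (λ l → hasOcc s (a ∷ word l)) (gen m h b R′) ≡ lag (T m (below b R′)) s (below b R′ ∸ below a R)
  count-gen-cons m {h} {a} {b} {R} {R′} s len sorted a∉ R↭ b∉ = begin
    count (λ l → hasOcc s (a ∷ word l)) (gen m h b R′)
      ≡⟨ count-cong (gen m h b R′) (λ l∈ → cong (_≡ᵇ s) (occ-cons (gen-trace m len l∈))) ⟩
    count (λ l → (countBetween a b R′ + occ13-2 (word l)) ≡ᵇ s) (gen m h b R′)
      ≡⟨ count-lag (occ13-2 ∘ word) (gen m h b R′) s (countBetween a b R′) ⟩
    lag (λ s → count (hasOcc s ∘ word) (gen m h b R′)) s (countBetween a b R′)
      ≡⟨ lag-cong (λ s → count-gen m s len sorted b∉) s (countBetween a b R′) ⟩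
    lag (T m (below b R′)) s (countBetween a b R′)
      ≡⟨ cong (lag (T m (below b R′)) s) (trans (countBetween-below (↭.All-resp-↭ R↭ a∉))
           (cong (below b R′ ∸_) (count-↭ (_<ᵇ a) (↭-sym R↭)))) ⟩
    lag (T m (below b R′)) s (below b R′ ∸ below a R) ∎
    where open ≡-Reasoning

  picks-fresh : ∀ {R b R′} → Sorted R → (b , R′) ∈ picks R → All (b ≢_) R′
  picks-fresh s p∈ = AllPairs.head (Setoid↭.Unique-resp-↭ (setoid ℕ) (↭⇒↭ₛ (picks-↭ p∈)) (sorted-unique s))

  count-gen zero    {R = []}    zero    len s a∉ = refl
  count-gen zero    {R = []}    (suc s) len _ a∉ = refl
  count-gen (suc m) {h} {a} {R = x ∷ R} s len sorted a∉ = begin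
    count (hasOcc s ∘ word) (gen (suc m) h a (x ∷ R))
      ≡⟨ count-gen-suc m (hasOcc s) (λ _ k → lag (T m k) s (k ∸ j)) (ℕ.suc-injective len) sorted
           (λ h p∈ → count-gen-cons m s (picks-length p∈ len) (picks-sorted sorted p∈) a∉
                       (picks-↭ p∈) (picks-fresh sorted p∈)) ⟩
    ∑ (suc m) (λ k → ω k * lag (T m k) s (k ∸ j))
      ≡⟨ ∑-cong (suc m) (λ k k<n → ω-lag-T m k s (k ∸ j) (ℕ.≤-pred k<n)) ⟩
    ∑ (suc m) (λ k → 2 * lag (U m k) s (k ∸ j))
      ≡⟨ ∑-distrib (suc m) 2 (λ k → lag (U m k) s (k ∸ j)) ⟩
    2 * Y m j s ∎
    where
    open ≡-Reasoning
    j = below a (x ∷ R)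

  ∑-indicator : ∀ n k₀ (f : ℕ → ℕ) → ∑ n (λ k → if k ≡ᵇ k₀ then f k else 0) ≡ (if k₀ <ᵇ n then f k₀ else 0)
  ∑-indicator zero    k₀       f = refl
  ∑-indicator (suc n) zero     f = trans (cong (f 0 +_) (∑-zero n (λ _ _ → refl))) (ℕ.+-identityʳ (f 0))
  ∑-indicator (suc n) (suc k₀) f = ∑-indicator n k₀ (f ∘ suc)

  startsWith1-cons : ∀ i {h b R l} → Trace h b R l → startsWith1 i (1 ∷ word l) ≡ (b ≡ᵇ i)
  startsWith1-cons i end        = refl
  startsWith1-cons i (new _)    = refl
  startsWith1-cons i (step _ _) = refl

  -- The leading 1 has rank 0, so the next letter k + 2, whose rank is k, costs exactly k
  -- occurrences.
  g-U : ∀ m r k → g (2 + m) r (k + 2) ≡ (if k <ᵇ suc m then 2 * lag (U m k) r k else 0)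
  g-U m r k = begin
    g (2 + m) r (k + 2)
      ≡⟨ count-flatten p (suc m) ⟩
    count (p ∘ word) (graphs (suc m))
      ≡⟨ count-gen-suc m p φ (length-interval 3 m) (interval-sorted 2 (suc m)) count-φ ⟩
    ∑ (suc m) (λ k′ → ω k′ * φ (apply R (suc k′)) k′)
      ≡⟨ ∑-cong (suc m) term ⟩
    ∑ (suc m) (λ k′ → if k′ ≡ᵇ k then 2 * lag (U m k′) r k′ else 0)
      ≡⟨ ∑-indicator (suc m) k (λ k′ → 2 * lag (U m k′) r k′) ⟩
    (if k <ᵇ suc m then 2 * lag (U m k) r k else 0) ∎
    where
    open ≡-Reasoning
    R = interval 2 (suc m)
    1< : All (1 <_) R
    1< = AllPairs.head (interval-sorted 1 (2 + m))
    p : List ℕ → Bool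
    p u = startsWith1 (k + 2) u ∧ hasOcc r u
    φ : ℕ → ℕ → ℕ
    φ b k′ = if b ≡ᵇ (k + 2) then lag (T m k′) r k′ else 0
    count-∧ : ∀ c (q : Graph → Bool) ls → count (λ l → c ∧ q l) ls ≡ (if c then count q ls else 0)
    count-∧ true  q ls = refl
    count-∧ false q ls = count-false ls
    count-φ : ∀ h {b R′} → (b , R′) ∈ picks R →
              count (λ l → p (1 ∷ word l)) (gen m h b R′) ≡ φ b (below b R′)
    count-φ h {b} {R′} p∈ = begin
      count (λ l → p (1 ∷ word l)) (gen m h b R′)
        ≡⟨ count-cong (gen m h b R′) (λ {l} l∈ →
             cong (_∧ hasOcc r (1 ∷ word l)) (startsWith1-cons (k + 2) (gen-trace m len′ l∈))) ⟩
      count (λ l → (b ≡ᵇ (k + 2)) ∧ hasOcc r (1 ∷ word l)) (gen m h b R′)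
        ≡⟨ count-∧ (b ≡ᵇ (k + 2)) (λ l → hasOcc r (1 ∷ word l)) (gen m h b R′) ⟩
      (if b ≡ᵇ (k + 2) then count (λ l → hasOcc r (1 ∷ word l)) (gen m h b R′) else 0)
        ≡⟨ cong (λ n → if b ≡ᵇ (k + 2) then n else 0) (trans
             (count-gen-cons m r len′ (picks-sorted (interval-sorted 2 (suc m)) p∈) (All.map ℕ.<⇒≢ 1<)
               (picks-↭ p∈) (picks-fresh (interval-sorted 2 (suc m)) p∈))
             (cong (λ d → lag (T m (below b R′)) r (below b R′ ∸ d)) (below-minimum 1<))) ⟩
      φ b (below b R′) ∎
      where
      len′ = picks-length p∈ (length-interval 2 (suc m))
    term : ∀ k′ → k′ < suc m → ω k′ * φ (apply R (suc k′)) k′ ≡ (if k′ ≡ᵇ k then 2 * lag (U m k′) r k′ else 0)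
    term k′ k′<n
      -- The letter of rank `k′` in the interval starting at 2 is `2 + k′`; it remains to see
      -- whether it is the prescribed one.
      rewrite trans (cong (λ u → apply u (suc k′)) (sym (map-id R))) (apply-map-interval id 2 (suc m) k′<n)
            | ℕ.+-comm k 2 with k′ ≡ᵇ k
    ... | true  = ω-lag-T m k′ r k′ (ℕ.≤-pred k′<n)
    ... | false = ℕ.*-zeroʳ (ω k′)

  g-U-≤ : ∀ m r k → k ≤ m → k ≤ r → g (2 + m) r (k + 2) ≡ 2 * U m k (r ∸ k)
  g-U-≤ m r k k≤m k≤r = trans (g-U m r k)
    (trans (cong (if_then 2 * lag (U m k) r k else 0) (<ᵇ-true (s≤s k≤m)))
           (cong (2 *_) (lag-≤ (U m k) k≤r)))

  g-U-> : ∀ m r k → r < k → g (2 + m) r (k + 2) ≡ 0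
  g-U-> m r k r<k = trans (g-U m r k)
    (trans (cong (λ n → if k <ᵇ suc m then 2 * n else 0) (lag-> (U m k) r<k)) (both (k <ᵇ suc m)))
    where
    both : ∀ b → (if b then 0 else 0) ≡ 0
    both true  = refl
    both false = refl

module GeneratingFunctions where

  open Enumeration
  open import Algebra.Bundles using (CommutativeSemigroup)
  import Algebra.Properties.CommutativeSemigroup as CommutativeSemigroupProperties
  open import Data.Bool using (true; false; if_then_else_)
  open import Data.Nat as ℕ
    using (ℕ; zero; suc; _∸_; _≤_; _<_; _>_; _^_; _<ᵇ_; _≤′_; z≤n; s≤s; ≤′-refl; ≤′-step)
  import Data.Nat.Properties as ℕ
  open import Data.Nat.Induction using (<-rec)
  open import Data.Nat.Tactic.RingSolver using () renaming (solve-∀ to solveℕ-∀)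
  open import Data.Integer using (ℤ; +_; _+_; _*_; -_; _-_)
  import Data.Integer.Properties as ℤ
  open import Data.Integer.Tactic.RingSolver using (solve-∀)
  import Data.Rational as ℚ
  import Data.Rational.Properties as ℚ
  open import Data.Rational.Solver using (module +-*-Solver)
  open import Data.Rational.Unnormalised as ℚᵘ using (mkℚᵘ; *≡*)
  import Data.Rational.Unnormalised.Properties as ℚᵘ
  open import Data.List using (List; []; _∷_)
  open import Data.Product using (_,_)
  open import Data.Sum using (inj₁; inj₂)
  open import Function using (_∘_)
  open import Relation.Binary.PropositionalEquality
  open ≡-Reasoning

  -- Convolution of power series.

  tail : Series → Series
  tail f = f ∘ suc

  sumTo-cong : ∀ {f h : ℕ → ℤ} → f ≗ h → ∀ n → sumTo f n ≡ sumTo h n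
  sumTo-cong f≗h zero    = f≗h 0
  sumTo-cong f≗h (suc n) = cong₂ _+_ (sumTo-cong f≗h n) (f≗h (suc n))

  ⊛-suc : ∀ f h n → (f ⊛ h) (suc n) ≡ f 0 * h (suc n) + (tail f ⊛ h) n
  ⊛-suc f h n = front (λ j → f j * h (suc n ∸ j)) n
    where
    front : ∀ u k → sumTo u (suc k) ≡ u 0 + sumTo (tail u) k
    front u zero    = refl
    front u (suc k) = trans (cong (_+ u (suc (suc k))) (front u k)) (ℤ.+-assoc (u 0) _ _)

  ⊛-sucʳ : ∀ f h n → (f ⊛ h) (suc n) ≡ f (suc n) * h 0 + (f ⊛ tail h) n
  ⊛-sucʳ f h zero    = ℤ.+-comm (f 0 * h 1) (f 1 * h 0)
  ⊛-sucʳ f h (suc n) = begin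
    (f ⊛ h) (suc (suc n))
      ≡⟨ ⊛-suc f h (suc n) ⟩
    f 0 * h (2 ℕ.+ n) + (tail f ⊛ h) (suc n)
      ≡⟨ cong (_+_ (f 0 * h (2 ℕ.+ n))) (⊛-sucʳ (tail f) h n) ⟩
    f 0 * h (2 ℕ.+ n) + (f (2 ℕ.+ n) * h 0 + (tail f ⊛ tail h) n)
      ≡⟨ swap (f 0 * h (2 ℕ.+ n)) (f (2 ℕ.+ n) * h 0) _ ⟩
    f (2 ℕ.+ n) * h 0 + (f 0 * h (2 ℕ.+ n) + (tail f ⊛ tail h) n)
      ≡⟨ cong (_+_ (f (2 ℕ.+ n) * h 0)) (⊛-suc f (tail h) n) ⟨
    f (2 ℕ.+ n) * h 0 + (f ⊛ tail h) (suc n) ∎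
    where
    swap : ∀ x y z → x + (y + z) ≡ y + (x + z)
    swap = solve-∀

  ⊛-cong : ∀ {f f′ h h′ : Series} → f ≗ f′ → h ≗ h′ → f ⊛ h ≗ f′ ⊛ h′
  ⊛-cong f≗ h≗ n = sumTo-cong (λ j → cong₂ _*_ (f≗ j) (h≗ (n ∸ j))) n

  ⊛-comm : ∀ f h → f ⊛ h ≗ h ⊛ f
  ⊛-comm f h zero    = ℤ.*-comm (f 0) (h 0)
  ⊛-comm f h (suc n) = begin
    (f ⊛ h) (suc n)                       ≡⟨ ⊛-suc f h n ⟩
    f 0 * h (suc n) + (tail f ⊛ h) n      ≡⟨ cong₂ _+_ (ℤ.*-comm (f 0) _) (⊛-comm (tail f) h n) ⟩
    h (suc n) * f 0 + (h ⊛ tail f) n      ≡⟨ ⊛-sucʳ h f n ⟨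
    (h ⊛ f) (suc n)                       ∎

  -- The combination has the shape that `⊛-suc` gives to `tail (f ⊛ h)`, as associativity requires.
  ⊛-linearˡ : ∀ c u v h → (λ i → c * u i + v i) ⊛ h ≗ λ n → c * (u ⊛ h) n + (v ⊛ h) n
  ⊛-linearˡ c u v h zero    = dist c (u 0) (v 0) (h 0)
    where
    dist : ∀ c x y z → (c * x + y) * z ≡ c * (x * z) + y * z
    dist = solve-∀
  ⊛-linearˡ c u v h (suc n) = begin
    ((λ i → c * u i + v i) ⊛ h) (suc n)
      ≡⟨ ⊛-suc (λ i → c * u i + v i) h n ⟩
    (c * u 0 + v 0) * h (suc n) + ((λ i → c * tail u i + tail v i) ⊛ h) n
      ≡⟨ cong (_+_ ((c * u 0 + v 0) * h (suc n))) (⊛-linearˡ c (tail u) (tail v) h n) ⟩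
    (c * u 0 + v 0) * h (suc n) + (c * (tail u ⊛ h) n + (tail v ⊛ h) n)
      ≡⟨ dist c (u 0) (v 0) (h (suc n)) _ _ ⟩
    c * (u 0 * h (suc n) + (tail u ⊛ h) n) + (v 0 * h (suc n) + (tail v ⊛ h) n)
      ≡⟨ cong₂ (λ x y → c * x + y) (⊛-suc u h n) (⊛-suc v h n) ⟨
    c * (u ⊛ h) (suc n) + (v ⊛ h) (suc n) ∎
    where
    dist : ∀ c x y z p q → (c * x + y) * z + (c * p + q) ≡ c * (x * z + p) + (y * z + q)
    dist = solve-∀

  ⊛-assoc : ∀ f h k → (f ⊛ h) ⊛ k ≗ f ⊛ (h ⊛ k)
  ⊛-assoc f h k zero    = ℤ.*-assoc (f 0) (h 0) (k 0)
  ⊛-assoc f h k (suc n) = begin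
    ((f ⊛ h) ⊛ k) (suc n)
      ≡⟨ ⊛-suc (f ⊛ h) k n ⟩
    f 0 * h 0 * k (suc n) + (tail (f ⊛ h) ⊛ k) n
      ≡⟨ cong (_+_ (f 0 * h 0 * k (suc n))) (⊛-cong {h = k} (⊛-suc f h) (λ _ → refl) n) ⟩
    f 0 * h 0 * k (suc n) + ((λ i → f 0 * tail h i + (tail f ⊛ h) i) ⊛ k) n
      ≡⟨ cong (_+_ (f 0 * h 0 * k (suc n))) (⊛-linearˡ (f 0) (tail h) (tail f ⊛ h) k n) ⟩
    f 0 * h 0 * k (suc n) + (f 0 * (tail h ⊛ k) n + ((tail f ⊛ h) ⊛ k) n)
      ≡⟨ regroup (f 0) (h 0) (k (suc n)) _ _ ⟩
    f 0 * (h 0 * k (suc n) + (tail h ⊛ k) n) + ((tail f ⊛ h) ⊛ k) n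
      ≡⟨ cong₂ (λ x y → f 0 * x + y) (sym (⊛-suc h k n)) (⊛-assoc (tail f) h k n) ⟩
    f 0 * (h ⊛ k) (suc n) + (tail f ⊛ (h ⊛ k)) n
      ≡⟨ ⊛-suc f (h ⊛ k) n ⟨
    (f ⊛ (h ⊛ k)) (suc n) ∎
    where
    regroup : ∀ x y z p q → x * y * z + (x * p + q) ≡ x * (y * z + p) + q
    regroup = solve-∀

  ⊛-zeroˡ : ∀ h → (λ _ → + 0) ⊛ h ≗ λ _ → + 0
  ⊛-zeroˡ h zero    = refl
  ⊛-zeroˡ h (suc n) = trans (⊛-suc (λ _ → + 0) h n) (trans (ℤ.+-identityˡ _) (⊛-zeroˡ h n))

  ⊛-identityˡ : ∀ h → oneS ⊛ h ≗ h
  ⊛-identityˡ h zero    = ℤ.*-identityˡ (h 0)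
  ⊛-identityˡ h (suc n) = begin
    (oneS ⊛ h) (suc n)                        ≡⟨ ⊛-suc oneS h n ⟩
    + 1 * h (suc n) + ((λ _ → + 0) ⊛ h) n     ≡⟨ cong₂ _+_ (ℤ.*-identityˡ (h (suc n))) (⊛-zeroˡ h n) ⟩
    h (suc n) + + 0                           ≡⟨ ℤ.+-identityʳ _ ⟩
    h (suc n)                                 ∎

  powS-+ : ∀ f m n → powS f m ⊛ powS f n ≗ powS f (m ℕ.+ n)
  powS-+ f zero    n i = ⊛-identityˡ (powS f n) i
  powS-+ f (suc m) n i = trans (⊛-assoc f (powS f m) (powS f n) i)
                               (⊛-cong {f = f} (λ _ → refl) (powS-+ f m n) i)

  ⊛-scaleʳ : ∀ f c h → f ⊛ scaleS c h ≗ scaleS c (f ⊛ h)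
  ⊛-scaleʳ f c h n = trans (sumTo-cong (λ j → swap (f j) c (h (n ∸ j))) n) (out n)
    where
    swap : ∀ x y z → x * (y * z) ≡ y * (x * z)
    swap = solve-∀
    out : ∀ {u : ℕ → ℤ} k → sumTo (λ j → c * u j) k ≡ c * sumTo u k
    out zero    = refl
    out {u} (suc k) = trans (cong (_+ c * u (suc k)) (out k)) (sym (ℤ.*-distribˡ-+ c (sumTo u k) (u (suc k))))

  ⊛-shiftʳ : ∀ f k h → f ⊛ shiftS k h ≗ shiftS k (f ⊛ h)
  ⊛-shiftʳ f zero    h n       = refl
  ⊛-shiftʳ f (suc k) h zero    = ℤ.*-zeroʳ (f 0)
  ⊛-shiftʳ f (suc k) h (suc n) = begin
    (f ⊛ shiftS (suc k) h) (suc n)           ≡⟨ ⊛-sucʳ f (shiftS (suc k) h) n ⟩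
    f (suc n) * + 0 + (f ⊛ shiftS k h) n     ≡⟨ cong (_+ (f ⊛ shiftS k h) n) (ℤ.*-zeroʳ (f (suc n))) ⟩
    + 0 + (f ⊛ shiftS k h) n                 ≡⟨ ℤ.+-identityˡ _ ⟩
    (f ⊛ shiftS k h) n                       ≡⟨ ⊛-shiftʳ f k h n ⟩
    shiftS k (f ⊛ h) n                       ∎

  shiftS-cong : ∀ k {f h : Series} → f ≗ h → shiftS k f ≗ shiftS k h
  shiftS-cong k f≗h n = cong (if n <ᵇ k then + 0 else_) (f≗h (n ∸ k))

  -- The operators `S - c` and proper fractions.

  δ : ℤ → Series → Series
  δ c f i = f (suc i) - c * f i

  δ^ : ℤ → ℕ → Series → Series
  δ^ c zero    f = f
  δ^ c (suc n) f = δ c (δ^ c n f)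

  δ-cong : ∀ c {f h} → f ≗ h → δ c f ≗ δ c h
  δ-cong c f≗h i = cong₂ (λ x y → x - c * y) (f≗h (suc i)) (f≗h i)

  δ^-cong : ∀ c n {f h} → f ≗ h → δ^ c n f ≗ δ^ c n h
  δ^-cong c zero    f≗h = f≗h
  δ^-cong c (suc n) f≗h = δ-cong c (δ^-cong c n f≗h)

  δ-linear : ∀ c b u v → δ c (λ i → b * u i + v i) ≗ λ i → b * δ c u i + δ c v i
  δ-linear c b u v i = eq c b (u (suc i)) (v (suc i)) (u i) (v i)
    where
    eq : ∀ c b x y z w → (b * x + y) - c * (b * z + w) ≡ b * (x - c * z) + (y - c * w)
    eq = solve-∀

  δ^-linear : ∀ c n b u v → δ^ c n (λ i → b * u i + v i) ≗ λ i → b * δ^ c n u i + δ^ c n v i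
  δ^-linear c zero    b u v i = refl
  δ^-linear c (suc n) b u v i = trans (δ-cong c (δ^-linear c n b u v) i)
                                      (δ-linear c b (δ^ c n u) (δ^ c n v) i)

  δ-comm : ∀ c d f → δ c (δ d f) ≗ δ d (δ c f)
  δ-comm c d f i = eq c d (f (suc (suc i))) (f (suc i)) (f i)
    where
    eq : ∀ c d x y z → (x - d * y) - c * (y - d * z) ≡ (x - c * y) - d * (y - c * z)
    eq = solve-∀

  δ^-δ : ∀ c n d f → δ^ c n (δ d f) ≗ δ d (δ^ c n f)
  δ^-δ c zero    d f i = refl
  δ^-δ c (suc n) d f i = trans (δ-cong c (δ^-δ c n d f) i) (δ-comm c d (δ^ c n f) i)

  δ^-tail : ∀ c n f → δ^ c n (tail f) ≗ tail (δ^ c n f)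
  δ^-tail c zero    f i = refl
  δ^-tail c (suc n) f i = δ-cong c (δ^-tail c n f) i

  δ^-shift : ∀ c n d f i → δ^ c n f (d ℕ.+ i) ≡ δ^ c n (λ k → f (d ℕ.+ k)) i
  δ^-shift c n zero    f i = refl
  δ^-shift c n (suc d) f i = trans (sym (δ^-tail c n f (d ℕ.+ i))) (δ^-shift c n d (tail f) i)

  -- Multiplication by 1 - c x acts on coefficients as `S - c`, one index later.
  linear-⊛ : ∀ L c → L 0 ≡ + 1 → L 1 ≡ - c → (∀ i → L (2 ℕ.+ i) ≡ + 0) →
             ∀ f n → (L ⊛ f) (suc n) ≡ δ c f n
  linear-⊛ L c L₀ L₁ L₂ f n = begin
    (L ⊛ f) (suc n)                      ≡⟨ ⊛-suc L f n ⟩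
    L 0 * f (suc n) + (tail L ⊛ f) n     ≡⟨ cong₂ (λ x y → x * f (suc n) + y) L₀ (rest n) ⟩
    + 1 * f (suc n) + - c * f n          ≡⟨ eq (f (suc n)) (f n) c ⟩
    f (suc n) - c * f n                  ∎
    where
    eq : ∀ x y c → + 1 * x + - c * y ≡ x - c * y
    eq = solve-∀
    rest : ∀ n → (tail L ⊛ f) n ≡ - c * f n
    rest zero    = cong (_* f 0) L₁
    rest (suc n) = begin
      (tail L ⊛ f) (suc n)
        ≡⟨ ⊛-suc (tail L) f n ⟩
      L 1 * f (suc n) + (tail (tail L) ⊛ f) n
        ≡⟨ cong₂ (λ x y → x * f (suc n) + y) L₁
                 (trans (⊛-cong {h = f} L₂ (λ _ → refl) n) (⊛-zeroˡ f n)) ⟩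
      - c * f (suc n) + + 0
        ≡⟨ ℤ.+-identityʳ (- c * f (suc n)) ⟩
      - c * f (suc n) ∎

  powS-⊛ : ∀ L c → (∀ f n → (L ⊛ f) (suc n) ≡ δ c f n) →
           ∀ p f n → (powS L p ⊛ f) (p ℕ.+ n) ≡ δ^ c p f n
  powS-⊛ L c L⊛ zero    f n = ⊛-identityˡ f n
  powS-⊛ L c L⊛ (suc p) f n = begin
    (powS L (suc p) ⊛ f) (suc (p ℕ.+ n))
      ≡⟨ ⊛-assoc L (powS L p) f (suc (p ℕ.+ n)) ⟩
    (L ⊛ (powS L p ⊛ f)) (suc (p ℕ.+ n))
      ≡⟨ L⊛ (powS L p ⊛ f) (p ℕ.+ n) ⟩
    δ c (powS L p ⊛ f) (p ℕ.+ n)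
      ≡⟨ cong₂ (λ x y → x - c * y)
               (trans (cong (powS L p ⊛ f) (sym (ℕ.+-suc p n))) (powS-⊛ L c L⊛ p f (suc n)))
               (powS-⊛ L c L⊛ p f n) ⟩
    δ^ c (suc p) f n ∎

  D : ℕ → ℕ → Series
  D p q = powS oneMinusX p ⊛ powS oneMinus2X q

  E : ℕ → ℕ → Series → Series
  E p q f = δ^ (+ 1) p (δ^ (+ 2) q f)

  oneMinusX-⊛ : ∀ f n → (oneMinusX ⊛ f) (suc n) ≡ δ (+ 1) f n
  oneMinusX-⊛ = linear-⊛ oneMinusX (+ 1) refl refl (λ _ → refl)

  oneMinus2X-⊛ : ∀ f n → (oneMinus2X ⊛ f) (suc n) ≡ δ (+ 2) f n
  oneMinus2X-⊛ = linear-⊛ oneMinus2X (+ 2) refl refl (λ _ → refl)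

  -- Hence `E p q f` vanishes exactly when the product of f with (1-x)^p (1-2x)^q is a polynomial of
  -- degree less than p + q.
  D-⊛ : ∀ p q f n → (D p q ⊛ f) (p ℕ.+ (q ℕ.+ n)) ≡ E p q f n
  D-⊛ p q f n = begin
    (D p q ⊛ f) (p ℕ.+ (q ℕ.+ n))
      ≡⟨ ⊛-assoc (powS oneMinusX p) (powS oneMinus2X q) f (p ℕ.+ (q ℕ.+ n)) ⟩
    (powS oneMinusX p ⊛ f₂) (p ℕ.+ (q ℕ.+ n))
      ≡⟨ powS-⊛ oneMinusX (+ 1) oneMinusX-⊛ p f₂ (q ℕ.+ n) ⟩
    δ^ (+ 1) p f₂ (q ℕ.+ n)
      ≡⟨ δ^-shift (+ 1) p q f₂ n ⟩
    δ^ (+ 1) p (λ i → f₂ (q ℕ.+ i)) n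
      ≡⟨ δ^-cong (+ 1) p (powS-⊛ oneMinus2X (+ 2) oneMinus2X-⊛ q f) n ⟩
    E p q f n ∎
    where f₂ = powS oneMinus2X q ⊛ f

  E-cong : ∀ p q {f h} → f ≗ h → E p q f ≗ E p q h
  E-cong p q f≗h = δ^-cong (+ 1) p (δ^-cong (+ 2) q f≗h)

  E-linear : ∀ p q b u v → E p q (λ i → b * u i + v i) ≗ λ i → b * E p q u i + E p q v i
  E-linear p q b u v i = trans (δ^-cong (+ 1) p (δ^-linear (+ 2) q b u v) i)
                               (δ^-linear (+ 1) p b (δ^ (+ 2) q u) (δ^ (+ 2) q v) i)

  E-tail : ∀ p q f → E p q (tail f) ≗ tail (E p q f)
  E-tail p q f i = trans (δ^-cong (+ 1) p (δ^-tail (+ 2) q f) i) (δ^-tail (+ 1) p (δ^ (+ 2) q f) i)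

  E-δ₁ : ∀ p q f → E (suc p) q f ≗ E p q (δ (+ 1) f)
  E-δ₁ p q f i = sym (trans (δ^-cong (+ 1) p (δ^-δ (+ 2) q (+ 1) f) i)
                            (δ^-δ (+ 1) p (+ 1) (δ^ (+ 2) q f) i))

  E-δ₂ : ∀ p q f → E p (suc q) f ≗ E p q (δ (+ 2) f)
  E-δ₂ p q f i = sym (δ^-cong (+ 1) p (δ^-δ (+ 2) q (+ 2) f) i)

  -- The sequences f(i) = a(i) + b(i) 2^i with polynomials deg a < p, deg b < q;
  -- equivalently, their generating functions are proper fractions over (1-x)^p (1-2x)^q.
  record V (p q : ℕ) (f : Series) : Set where
    constructor mkV
    field vanish : ∀ i → E p q f i ≡ + 0
  open V

  V-cong : ∀ {p q f h} → f ≗ h → V p q f → V p q h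
  V-cong {p} {q} f≗h v .vanish i = trans (sym (E-cong p q f≗h i)) (v .vanish i)

  V-zero : ∀ p q → V p q (λ _ → + 0)
  V-zero p q .vanish i = trans (δ^-cong (+ 1) p (zeros (+ 2) q) i) (zeros (+ 1) p i)
    where
    zeros : ∀ c n → δ^ c n (λ _ → + 0) ≗ λ _ → + 0
    zeros c zero    i = refl
    zeros c (suc n) i = trans (δ-cong c (zeros c n) i) (cong (λ z → + 0 - z) (ℤ.*-zeroʳ c))

  V-linear : ∀ {p q u v} b → V p q u → V p q v → V p q (λ i → b * u i + v i)
  V-linear {p} {q} {u} {v} b u∈ v∈ .vanish i = begin
    E p q (λ i → b * u i + v i) i      ≡⟨ E-linear p q b u v i ⟩
    b * E p q u i + E p q v i          ≡⟨ cong₂ (λ x y → b * x + y) (u∈ .vanish i) (v∈ .vanish i) ⟩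
    b * + 0 + + 0                      ≡⟨ cong (_+ + 0) (ℤ.*-zeroʳ b) ⟩
    + 0                                ∎

  V-scale : ∀ {p q u} b → V p q u → V p q (λ i → b * u i)
  V-scale {p} {q} {u} b u∈ = V-cong (λ i → ℤ.+-identityʳ (b * u i)) (V-linear b u∈ (V-zero p q))

  V-+ : ∀ {p q u v} → V p q u → V p q v → V p q (λ i → u i + v i)
  V-+ {u = u} {v} u∈ v∈ = V-cong (λ i → cong (_+ v i) (ℤ.*-identityˡ (u i))) (V-linear (+ 1) u∈ v∈)

  V-tail : ∀ {p q f} → V p q f → V p q (tail f)
  V-tail {p} {q} {f} v .vanish i = trans (E-tail p q f i) (v .vanish (suc i))

  V-shift : ∀ {p q f} d → V p q f → V p q (λ i → f (d ℕ.+ i))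
  V-shift zero    v = v
  V-shift (suc d) v = V-shift d (V-tail v)

  V-suc₁ : ∀ {p q f} → V p q (δ (+ 1) f) → V (suc p) q f
  V-suc₁ {p} {q} {f} v .vanish i = trans (E-δ₁ p q f i) (v .vanish i)

  V-suc₂ : ∀ {p q f} → V p q (δ (+ 2) f) → V p (suc q) f
  V-suc₂ {p} {q} {f} v .vanish i = trans (E-δ₂ p q f i) (v .vanish i)

  V-mono : ∀ {p p′ q q′ f} → p ≤ p′ → q ≤ q′ → V p q f → V p′ q′ f
  V-mono p≤ q≤ v = mono₁ (ℕ.≤⇒≤′ p≤) (mono₂ (ℕ.≤⇒≤′ q≤) v)
    where
    V-δ : ∀ {p q f} c → V p q f → V p q (δ c f)
    V-δ {f = f} c v = V-cong (λ i → eq (f (suc i)) c (f i)) (V-linear (- c) v (V-tail v))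
      where
      eq : ∀ x c y → - c * y + x ≡ x - c * y
      eq = solve-∀
    mono₁ : ∀ {p p′ q f} → p ≤′ p′ → V p q f → V p′ q f
    mono₁ ≤′-refl      v = v
    mono₁ (≤′-step p≤) v = V-suc₁ (V-δ (+ 1) (mono₁ p≤ v))
    mono₂ : ∀ {p q q′ f} → q ≤′ q′ → V p q f → V p q′ f
    mono₂ ≤′-refl      v = v
    mono₂ (≤′-step q≤) v = V-suc₂ (V-δ (+ 2) (mono₂ q≤ v))

  -- Recurrences and pole orders of the sequences `a j s`.

  ∑ℤ : ℕ → (ℕ → ℤ) → ℤ
  ∑ℤ zero    f = + 0
  ∑ℤ (suc n) f = f 0 + ∑ℤ n (f ∘ suc)

  ∑ℤ-cong : ∀ n {f h : ℕ → ℤ} → (∀ k → k < n → f k ≡ h k) → ∑ℤ n f ≡ ∑ℤ n h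
  ∑ℤ-cong zero    f≡h = refl
  ∑ℤ-cong (suc n) f≡h = cong₂ _+_ (f≡h 0 (s≤s z≤n)) (∑ℤ-cong n (λ k k<n → f≡h (suc k) (s≤s k<n)))

  V-∑ : ∀ {p q} n {f : ℕ → Series} → (∀ k → k < n → V p q (f k)) →
        V p q (λ i → ∑ℤ n (λ k → f k i))
  V-∑ zero    v = V-zero _ _
  V-∑ (suc n) v = V-+ (v 0 (s≤s z≤n)) (V-∑ n (λ k k<n → v (suc k) (s≤s k<n)))

  E-absorb : ∀ p q u {v} → V p q v → E p q (λ i → u i + v i) ≗ E p q u
  E-absorb p q u {v} v∈ i = begin
    E p q (λ i → u i + v i) i          ≡⟨ E-cong p q (λ i → cong (_+ v i) (ℤ.*-identityˡ (u i))) i ⟨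
    E p q (λ i → + 1 * u i + v i) i    ≡⟨ E-linear p q (+ 1) u v i ⟩
    + 1 * E p q u i + E p q v i        ≡⟨ cong₂ _+_ (ℤ.*-identityˡ (E p q u i)) (v∈ .vanish i) ⟩
    E p q u i + + 0                    ≡⟨ ℤ.+-identityʳ (E p q u i) ⟩
    E p q u i                          ∎

  pos-∑ : ∀ n f → + ∑ n f ≡ ∑ℤ n (λ k → + f k)
  pos-∑ zero    f = refl
  pos-∑ (suc n) f = cong (_+_ (+ f 0)) (pos-∑ n (f ∘ suc))

  -- The numbers U m j s with j + s = r fixed, starting at m = r: from there on the recurrence
  -- has no boundary effects, so that this is an exponential polynomial in i.
  a : ℕ → ℕ → Series
  a j s i = + U (j ℕ.+ s ℕ.+ i) j s

  -- The contributions of next letters of rank below and above j. The sequence `a k s` starts at m =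
  -- k + s, so in the former the index moves by j - k; in the latter the starting points agree.
  lower upper : ℕ → ℕ → Series
  lower j s i = ∑ℤ j (λ k → a k s ((j ∸ k) ℕ.+ i))
  upper j s i = ∑ℤ s (λ t → a (suc t ℕ.+ j) (s ∸ suc t) i)

  pos-Y : ∀ j s i → + Y (j ℕ.+ s ℕ.+ i) j s ≡ lower j s i + (a j s i + upper j s i)
  pos-Y j s i = begin
    + Y m j s
      ≡⟨ cong +_ (Y-split j s i) ⟩
    + ∑ j (λ k → U m k s) + (+ U m j s + + ∑ s (λ t → U m (suc t ℕ.+ j) (s ∸ suc t)))
      ≡⟨ cong₂ (λ x y → x + (a j s i + y))
               (trans (pos-∑ j (λ k → U m k s)) (∑ℤ-cong j lowerTerm))
               (trans (pos-∑ s (λ t → U m (suc t ℕ.+ j) (s ∸ suc t))) (∑ℤ-cong s upperTerm)) ⟩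
    lower j s i + (a j s i + upper j s i) ∎
    where
    m = j ℕ.+ s ℕ.+ i
    lowerTerm : ∀ k → k < j → + U m k s ≡ a k s ((j ∸ k) ℕ.+ i)
    lowerTerm k k<j = cong (λ l → + U l k s)
      (trans (cong (λ l → l ℕ.+ s ℕ.+ i) (sym (ℕ.m+[n∸m]≡n (ℕ.<⇒≤ k<j)))) (eq k (j ∸ k) s i))
      where
      eq : ∀ k d s i → k ℕ.+ d ℕ.+ s ℕ.+ i ≡ k ℕ.+ s ℕ.+ (d ℕ.+ i)
      eq = solveℕ-∀
    upperTerm : ∀ t → t < s → + U m (suc t ℕ.+ j) (s ∸ suc t) ≡ a (suc t ℕ.+ j) (s ∸ suc t) i
    upperTerm t t<s = cong (λ l → + U l (suc t ℕ.+ j) (s ∸ suc t))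
      (trans (cong (λ l → j ℕ.+ l ℕ.+ i) (sym (ℕ.m+[n∸m]≡n t<s))) (eq j (suc t) (s ∸ suc t) i))
      where
      eq : ∀ j t d i → j ℕ.+ (t ℕ.+ d) ℕ.+ i ≡ t ℕ.+ j ℕ.+ d ℕ.+ i
      eq = solveℕ-∀

  δ-a : ∀ j s → δ (+ 1) (a (suc j) s) ≗ λ i → lower (suc j) s i + upper (suc j) s i
  δ-a j s i = begin
    + U (suc j ℕ.+ s ℕ.+ suc i) (suc j) s - + 1 * x
      ≡⟨ cong (λ l → + U l (suc j) s - + 1 * x) (ℕ.+-suc (suc j ℕ.+ s) i) ⟩
    + (Y m (suc j) s ℕ.+ 0) - + 1 * x
      ≡⟨ cong (λ y → + y - + 1 * x) (ℕ.+-identityʳ (Y m (suc j) s)) ⟩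
    + Y m (suc j) s - + 1 * x
      ≡⟨ cong (λ y → y - + 1 * x) (pos-Y (suc j) s i) ⟩
    (lower (suc j) s i + (x + upper (suc j) s i)) - + 1 * x
      ≡⟨ eq (lower (suc j) s i) x (upper (suc j) s i) ⟩
    lower (suc j) s i + upper (suc j) s i ∎
    where
    m = suc j ℕ.+ s ℕ.+ i
    x = a (suc j) s i
    eq : ∀ l x u → (l + (x + u)) - + 1 * x ≡ l + u
    eq = solve-∀

  -- Half of `a 0 (suc s)`: the weight 2 of a right-to-left minimum is left out. That weight is the
  -- factor 2 in front of c_{r,0} in P_r.
  α : ℕ → Series
  α s i = + Y (s ℕ.+ i) 0 (suc s)

  a-0-suc : ∀ s i → a 0 (suc s) i ≡ + 2 * α s i
  a-0-suc s i = ℤ.pos-* 2 (Y (s ℕ.+ i) 0 (suc s))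

  δ-α : ∀ s → δ (+ 2) (α s) ≗ upper 0 (suc s)
  δ-α s i = begin
    + Y (s ℕ.+ suc i) 0 (suc s) - + 2 * α s i
      ≡⟨ cong₂ (λ l y → + Y l 0 (suc s) - y) (ℕ.+-suc s i) (sym (a-0-suc s i)) ⟩
    + Y (suc s ℕ.+ i) 0 (suc s) - a 0 (suc s) i
      ≡⟨ cong (_- a 0 (suc s) i) (pos-Y 0 (suc s) i) ⟩
    (+ 0 + (a 0 (suc s) i + upper 0 (suc s) i)) - a 0 (suc s) i
      ≡⟨ eq (a 0 (suc s) i) (upper 0 (suc s) i) ⟩
    upper 0 (suc s) i ∎
    where
    eq : ∀ x u → (+ 0 + (x + u)) - x ≡ u
    eq = solve-∀

  U-0-0 : ∀ m → U m 0 0 ≡ 2 ℕ.^ m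
  U-0-0 zero    = refl
  U-0-0 (suc m) = cong (2 ℕ.*_) (begin
    Y m 0 0           ≡⟨ Y-split 0 0 m ⟩
    U m 0 0 ℕ.+ 0     ≡⟨ ℕ.+-identityʳ _ ⟩
    U m 0 0           ≡⟨ U-0-0 m ⟩
    2 ℕ.^ m           ∎)

  AV : ℕ → ℕ → Set
  AV j s = V (j ℕ.+ 2 ℕ.* s) (suc s) (a j s)

  -- Raising the rank by t ≥ 1 at the cost of t occurrences changes the weight to j + 2s - t and the
  -- order in `S - 2` to s - t + 1, so both drop below the values for `a j s`.
  upper-V : ∀ j s {p q} → j ℕ.+ 2 ℕ.* s ≤ suc p → s ≤ q →
            (∀ t → t < s → AV (suc t ℕ.+ j) (s ∸ suc t)) → V p q (upper j s)
  upper-V j s {p} {q} p≥ q≥ a∈ = V-∑ s λ t t<s →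
    V-mono (fit t t<s)
           (ℕ.≤-trans (subst (suc (s ∸ suc t) ≤_) (ℕ.m+[n∸m]≡n t<s) (s≤s (ℕ.m≤n+m (s ∸ suc t) t))) q≥)
           (a∈ t t<s)
    where
    fit : ∀ t → t < s → suc t ℕ.+ j ℕ.+ 2 ℕ.* (s ∸ suc t) ≤ p
    fit t t<s = ℕ.≤-pred (ℕ.≤-trans
      (subst₂ _≤_ refl (trans (eq t j (s ∸ suc t)) (cong (λ l → j ℕ.+ 2 ℕ.* l) (ℕ.m+[n∸m]≡n t<s)))
              (ℕ.m≤m+n _ t)) p≥)
      where
      eq : ∀ t j d → suc (suc t ℕ.+ j ℕ.+ 2 ℕ.* d) ℕ.+ t ≡ j ℕ.+ 2 ℕ.* (suc t ℕ.+ d)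
      eq = solveℕ-∀

  lower-V : ∀ j s {p} → j ℕ.+ 2 ℕ.* s ≤ suc p → (∀ k → k < j → AV k s) → V p (suc s) (lower j s)
  lower-V j s {p} p≥ a∈ = V-∑ j λ k k<j →
    V-shift {f = a k s} (j ∸ k)
      (V-mono (ℕ.≤-pred (ℕ.≤-trans (ℕ.+-monoˡ-≤ (2 ℕ.* s) k<j) p≥)) ℕ.≤-refl (a∈ k k<j))

  ∸-< : ∀ {t s} → t < s → s ∸ suc t < s
  ∸-< {t} {suc s} _ = s≤s (ℕ.m∸n≤m s t)

  -- At rank 0 the recurrence adds a factor `S - 2` but no `S - 1`. With r = s + 1 this gives p = 2r
  -- - 1, one better than `AV 0 r` and exactly the exponent of 1 - x in the theorem.
  α-V′ : ∀ s → (∀ {s′} → s′ < suc s → ∀ j → AV j s′) → V (suc (2 ℕ.* s)) (2 ℕ.+ s) (α s)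
  α-V′ s a∈ = V-suc₂ (V-cong (λ i → sym (δ-α s i))
    (upper-V 0 (suc s) (ℕ.≤-reflexive (ℕ.*-suc 2 s)) ℕ.≤-refl
      (λ t t<s → a∈ (∸-< t<s) (suc t ℕ.+ 0))))

  -- Lexicographic induction on (s , j): `lower` keeps s and decreases j, while `upper` increases j
  -- but decreases s.
  a-V : ∀ s j → AV j s
  a-V = <-rec (λ s → ∀ j → AV j s) outer
    where
    zeroth : ∀ s → (∀ {s′} → s′ < s → ∀ j → AV j s′) → AV 0 s
    zeroth zero    _  = V-suc₂ (mkV λ i →
      trans (cong₂ (λ x y → + x - + 2 * + y) (U-0-0 (suc i)) (U-0-0 i))
            (trans (cong (_- + 2 * + (2 ℕ.^ i)) (ℤ.pos-* 2 (2 ℕ.^ i)))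
                   (ℤ.+-inverseʳ (+ 2 * + (2 ℕ.^ i)))))
    zeroth (suc s) ih =
      V-mono (ℕ.≤-trans (ℕ.n≤1+n _) (ℕ.≤-reflexive (sym (ℕ.*-suc 2 s)))) ℕ.≤-refl
             (V-cong (λ i → sym (a-0-suc s i)) (V-scale (+ 2) (α-V′ s ih)))

    outer : ∀ s → (∀ {s′} → s′ < s → ∀ j → AV j s′) → ∀ j → AV j s
    outer s ih = <-rec (λ j → AV j s) inner
      where
      inner : ∀ j → (∀ {k} → k < j → AV k s) → AV j s
      inner zero    _   = zeroth s ih
      inner (suc j) ihj = V-suc₁ (V-cong (λ i → sym (δ-a j s i))
        (V-+ (lower-V (suc j) s ℕ.≤-refl (λ k → ihj))
             (upper-V (suc j) s ℕ.≤-refl (ℕ.n≤1+n s) (λ t t<s → ih (∸-< t<s) (suc t ℕ.+ suc j)))))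

  α-V : ∀ s → V (suc (2 ℕ.* s)) (2 ℕ.+ s) (α s)
  α-V s = α-V′ s (λ {s′} _ → a-V s′)

  upper-0-suc : ∀ s → upper 0 (suc s) ≗ λ i → a 1 s i + upper 1 s i
  upper-0-suc s i = cong (_+_ (a 1 s i))
    (∑ℤ-cong s (λ t _ → cong (λ j → a (suc j) (s ∸ suc t) i) (sym (ℕ.+-suc t 0))))

  -- The leading coefficient in front of 2^i.

  E-scale : ∀ p q b u → E p q (λ i → b * u i) ≗ λ i → b * E p q u i
  E-scale p q b u i = begin
    E p q (λ i → b * u i) i                          ≡⟨ E-cong p q (λ i → ℤ.+-identityʳ (b * u i)) i ⟨
    E p q (λ i → b * u i + + 0) i                    ≡⟨ E-linear p q b u (λ _ → + 0) i ⟩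
    b * E p q u i + E p q (λ _ → + 0) i              ≡⟨ cong (_+_ (b * E p q u i)) (V-zero p q .vanish i) ⟩
    b * E p q u i + + 0                              ≡⟨ ℤ.+-identityʳ (b * E p q u i) ⟩
    b * E p q u i                                    ∎

  -- Up to normalisation, the coefficients of the highest powers of i in front of 2^i.
  residue-a : ∀ s i → E (2 ℕ.* s) s (a 0 s) i ≡ + (2 ^ (2 ℕ.* s ℕ.+ i))
  residue-α : ∀ s i → E (suc (2 ℕ.* s)) (suc s) (α s) i ≡ + (2 ^ (suc (2 ℕ.* s) ℕ.+ i))

  residue-a zero    i = cong +_ (U-0-0 i)
  residue-a (suc s) i = subst (λ p → E p (suc s) (a 0 (suc s)) i ≡ + (2 ^ (p ℕ.+ i))) (sym (ℕ.*-suc 2 s)) (begin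
    E (suc m) (suc s) (a 0 (suc s)) i
      ≡⟨ E-cong (suc m) (suc s) (a-0-suc s) i ⟩
    E (suc m) (suc s) (λ i → + 2 * α s i) i
      ≡⟨ E-scale (suc m) (suc s) (+ 2) (α s) i ⟩
    -- The additional `S - 1` acts on multiples of 2^i as the identity, so only the factor 2 between
    -- `α` and `a 0` remains.
    + 2 * δ (+ 1) (E m (suc s) (α s)) i
      ≡⟨ cong₂ (λ x y → + 2 * (x - + 1 * y)) (residue-α s (suc i)) (residue-α s i) ⟩
    + 2 * (+ (2 ^ (m ℕ.+ suc i)) - + 1 * x)
      ≡⟨ cong (λ l → + 2 * (+ (2 ^ l) - + 1 * x)) (ℕ.+-suc m i) ⟩
    + 2 * (+ (2 ^ suc (m ℕ.+ i)) - + 1 * x)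
      ≡⟨ cong (λ y → + 2 * (y - + 1 * x)) (ℤ.pos-* 2 (2 ^ (m ℕ.+ i))) ⟩
    + 2 * (+ 2 * x - + 1 * x)
      ≡⟨ eq x ⟩
    + 2 * x
      ≡⟨ ℤ.pos-* 2 (2 ^ (m ℕ.+ i)) ⟨
    + (2 ^ (suc m ℕ.+ i)) ∎)
    where
    m = suc (2 ℕ.* s)
    x = + (2 ^ (m ℕ.+ i))
    eq : ∀ x → + 2 * (+ 2 * x - + 1 * x) ≡ + 2 * x
    eq = solve-∀

  residue-α s i = begin
    E (suc p) (suc s) (α s) i
      ≡⟨ E-δ₂ (suc p) s (α s) i ⟩
    E (suc p) s (δ (+ 2) (α s)) i
      ≡⟨ E-cong (suc p) s (λ k → trans (δ-α s k) (upper-0-suc s k)) i ⟩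
    -- Only the passage from `α s` through `a 1 s` to `a 0 s` keeps the full order in `S - 2`; the
    -- `upper` terms are already killed here.
    E (suc p) s (λ k → a 1 s k + upper 1 s k) i
      ≡⟨ E-absorb (suc p) s (a 1 s) (V-mono (ℕ.n≤1+n p) ℕ.≤-refl small) i ⟩
    E (suc p) s (a 1 s) i
      ≡⟨ E-δ₁ p s (a 1 s) i ⟩
    E p s (δ (+ 1) (a 1 s)) i
      ≡⟨ E-cong p s (δ-a 0 s) i ⟩
    E p s (λ k → lower 1 s k + upper 1 s k) i
      ≡⟨ E-absorb p s (lower 1 s) small i ⟩
    E p s (lower 1 s) i
      ≡⟨ E-cong p s (λ k → ℤ.+-identityʳ (a 0 s (suc k))) i ⟩
    E p s (tail (a 0 s)) i
      ≡⟨ E-tail p s (a 0 s) i ⟩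
    E p s (a 0 s) (suc i)
      ≡⟨ residue-a s (suc i) ⟩
    + (2 ^ (p ℕ.+ suc i))
      ≡⟨ cong (λ l → + (2 ^ l)) (ℕ.+-suc p i) ⟩
    + (2 ^ (suc p ℕ.+ i)) ∎
    where
    p = 2 ℕ.* s
    small : V p s (upper 1 s)
    small = upper-V 1 s ℕ.≤-refl ℕ.≤-refl (λ t _ → a-V (s ∸ suc t) (suc t ℕ.+ 1))

  -- Positivity of the first terms.

  U-≥ : ∀ m j s k → k ≤ m → lag (U m k) s (k ∸ j) ≤ U (suc m) j s
  U-≥ m j s k k≤m = ℕ.≤-trans (∑-≥ (suc m) (λ k → lag (U m k) s (k ∸ j)) k (s≤s k≤m)) (ω-≥ j)
    where
    ω-≥ : ∀ j {y} → y ≤ ω j ℕ.* y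
    ω-≥ zero    = ℕ.m≤m+n _ _
    ω-≥ (suc j) = ℕ.m≤m+n _ _

  -- A new first letter just above the old one creates a descent, which adds no occurrence.
  U-step : ∀ j s → U (j ℕ.+ s) j s > 0 → U (suc j ℕ.+ s) (suc j) s > 0
  U-step j s pos = ℕ.≤-trans pos (subst (_≤ U (suc j ℕ.+ s) (suc j) s)
    (cong (lag (U (j ℕ.+ s) j) s) (ℕ.m≤n⇒m∸n≡0 (ℕ.n≤1+n j)))
    (U-≥ (j ℕ.+ s) (suc j) s j (ℕ.m≤m+n j s)))

  -- witness: 1 3 2 4 5 ...
  U-0-1-pos : ∀ m → U (2 ℕ.+ m) 0 1 > 0
  U-0-1-pos zero    = s≤s z≤n
  U-0-1-pos (suc m) = ℕ.≤-trans (U-0-1-pos m) (U-≥ (2 ℕ.+ m) 0 1 0 z≤n)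

  -- witness: 1 (r+1) r 2 4 3 5 ... with r = s + 4
  Y-pos : ∀ s → Y (3 ℕ.+ s) 0 (4 ℕ.+ s) > 0
  Y-pos s = ℕ.≤-trans (ℕ.≤-trans (U-0-1-pos s) (U-≥ (2 ℕ.+ s) (3 ℕ.+ s) 1 0 z≤n))
    (subst (_≤ Y (3 ℕ.+ s) 0 (4 ℕ.+ s))
      (trans (lag-≤ (U (3 ℕ.+ s) (3 ℕ.+ s)) (ℕ.n≤1+n (3 ℕ.+ s)))
             (cong (U (3 ℕ.+ s) (3 ℕ.+ s)) (ℕ.m+n∸n≡m 1 (3 ℕ.+ s))))
      (∑-≥ (4 ℕ.+ s) (λ k → lag (U (3 ℕ.+ s) k) (4 ℕ.+ s) k) (3 ℕ.+ s) ℕ.≤-refl))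

  U-pos : ∀ j s → 4 ≤ j ℕ.+ s → U (j ℕ.+ s) j s > 0
  U-pos zero (suc (suc (suc (suc s)))) _ = ℕ.≤-trans (Y-pos s) (ℕ.m≤m+n _ _)
  U-pos zero (suc (suc (suc zero))) (s≤s (s≤s (s≤s ())))
  U-pos zero (suc (suc zero)) (s≤s (s≤s ()))
  U-pos zero (suc zero) (s≤s ())
  U-pos (suc j) s 4≤ with ℕ.m≤n⇒m<n∨m≡n 4≤
  ... | inj₁ (s≤s 4≤j+s) = U-step j s (U-pos j s 4≤j+s)
  ... | inj₂ eq = base j s (ℕ.suc-injective eq)
    where
    -- Values with total 4, checked by evaluation. Descending to total 3 would fail: `U 3 0 3` is 0.
    base : ∀ j s → 3 ≡ j ℕ.+ s → U (suc j ℕ.+ s) (suc j) s > 0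
    base zero                      .3 refl = s≤s z≤n
    base (suc zero)                .2 refl = s≤s z≤n
    base (suc (suc zero))          .1 refl = s≤s z≤n
    base (suc (suc (suc zero)))    .0 refl = s≤s z≤n

  -- Numerators of proper fractions and their degrees.

  ⊛-commutativeSemigroup : CommutativeSemigroup _ _
  ⊛-commutativeSemigroup = record
    { Carrier = Series
    ; _≈_     = _≗_
    ; _∙_     = _⊛_
    ; isCommutativeSemigroup = record
      { isSemigroup = record
        { isMagma = record
          { isEquivalence = record
            { refl  = λ _ → refl
            ; sym   = λ f≗h i → sym (f≗h i)
            ; trans = λ f≗h h≗k i → trans (f≗h i) (h≗k i)
            }
          ; ∙-cong = ⊛-cong
          }
        ; assoc = ⊛-assoc
        }
      ; comm = ⊛-comm
      }
    }

  open CommutativeSemigroupProperties ⊛-commutativeSemigroup using (interchange; x∙yz≈y∙xz)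

  D-+ : ∀ p q p′ q′ → D p q ⊛ D p′ q′ ≗ D (p ℕ.+ p′) (q ℕ.+ q′)
  D-+ p q p′ q′ i = trans
    (interchange (powS oneMinusX p) (powS oneMinus2X q) (powS oneMinusX p′) (powS oneMinus2X q′) i)
    (⊛-cong (powS-+ oneMinusX p p′) (powS-+ oneMinus2X q q′) i)

  D-suc₂ : ∀ p q f → D p (suc q) ⊛ f ≗ oneMinus2X ⊛ (D p q ⊛ f)
  D-suc₂ p q f i = trans
    (⊛-cong {h = f} (x∙yz≈y∙xz (powS oneMinusX p) oneMinus2X (powS oneMinus2X q)) (λ _ → refl) i)
    (⊛-assoc oneMinus2X (D p q) f i)

  -- A nonzero constant polynomial. For c ≠ 0 the operator `S - c` multiplies it by -c; applied to
  -- `oneS` this shows that `D p q` has degree exactly p + q.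
  record Spike (f : Series) : Set where
    field
      head≢0 : f 0 ≢ + 0
      tail≡0 : ∀ i → f (suc i) ≡ + 0
  open Spike

  δ^-Spike : ∀ c n {f} → c ≢ + 0 → Spike f → Spike (δ^ c n f)
  δ^-Spike c zero    c≢0 sp = sp
  δ^-Spike c (suc n) {f} c≢0 sp = record
    { head≢0 = λ δ≡0 → product≢0 (trans (eq (u 1) (c * u 0)) (cong₂ _-_ (tail≡0 ih 0) δ≡0))
    ; tail≡0 = λ i → trans (cong₂ (λ x y → x - c * y) (tail≡0 ih (suc i)) (tail≡0 ih i))
                           (cong (λ z → + 0 - z) (ℤ.*-zeroʳ c))
    }
    where
    u  = δ^ c n f
    ih = δ^-Spike c n c≢0 sp
    eq : ∀ x y → y ≡ x - (x - y)
    eq = solve-∀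
    product≢0 : c * u 0 ≢ + 0
    product≢0 p≡0 with ℤ.i*j≡0⇒i≡0∨j≡0 c p≡0
    ... | inj₁ c≡0 = c≢0 c≡0
    ... | inj₂ u≡0 = head≢0 ih u≡0

  D-coeff : ∀ p q n → D p q (p ℕ.+ q ℕ.+ n) ≡ E p q oneS n
  D-coeff p q n = begin
    D p q (p ℕ.+ q ℕ.+ n)              ≡⟨ ⊛-identityˡ (D p q) (p ℕ.+ q ℕ.+ n) ⟨
    (oneS ⊛ D p q) (p ℕ.+ q ℕ.+ n)     ≡⟨ ⊛-comm oneS (D p q) (p ℕ.+ q ℕ.+ n) ⟩
    (D p q ⊛ oneS) (p ℕ.+ q ℕ.+ n)     ≡⟨ cong (D p q ⊛ oneS) (ℕ.+-assoc p q n) ⟩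
    (D p q ⊛ oneS) (p ℕ.+ (q ℕ.+ n))   ≡⟨ D-⊛ p q oneS n ⟩
    E p q oneS n                       ∎

  E-oneS : ∀ p q → Spike (E p q oneS)
  E-oneS p q = δ^-Spike (+ 1) p (λ ()) (δ^-Spike (+ 2) q (λ ())
    (record { head≢0 = λ () ; tail≡0 = λ _ → refl }))

  -- The coefficient of the full product at `suc d` vanishes; separating the summand with `f 0`
  -- leaves the product with `tail f`.
  D-⊛-tail : ∀ {p q f} d → V p q f → p ℕ.+ q ≤ suc d →
             (D p q ⊛ tail f) d ≡ - (D p q (suc d) * f 0)
  D-⊛-tail {p} {q} {f} d v p+q≤ = begin
    (D p q ⊛ tail f) d                                          ≡⟨ eq (D p q (suc d) * f 0) _ ⟩
    (D p q (suc d) * f 0 + (D p q ⊛ tail f) d) - D p q (suc d) * f 0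
      ≡⟨ cong (_- D p q (suc d) * f 0) (trans (sym (⊛-sucʳ (D p q) f d)) vanishes) ⟩
    + 0 - D p q (suc d) * f 0                                   ≡⟨ ℤ.+-identityˡ _ ⟩
    - (D p q (suc d) * f 0)                                     ∎
    where
    eq : ∀ x y → y ≡ (x + y) - x
    eq = solve-∀
    vanishes : (D p q ⊛ f) (suc d) ≡ + 0
    vanishes = begin
      (D p q ⊛ f) (suc d)
        ≡⟨ cong (D p q ⊛ f) (ℕ.m+[n∸m]≡n p+q≤) ⟨
      (D p q ⊛ f) (p ℕ.+ q ℕ.+ (suc d ∸ (p ℕ.+ q)))
        ≡⟨ cong (D p q ⊛ f) (ℕ.+-assoc p q _) ⟩
      (D p q ⊛ f) (p ℕ.+ (q ℕ.+ (suc d ∸ (p ℕ.+ q))))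
        ≡⟨ D-⊛ p q f _ ⟩
      E p q f (suc d ∸ (p ℕ.+ q))
        ≡⟨ v .vanish _ ⟩
      + 0 ∎

  truncate : ℕ → Series → List ℤ
  truncate zero    f = []
  truncate (suc n) f = f 0 ∷ truncate n (tail f)

  coeff-truncate : ∀ n f → (∀ i → n ≤ i → f i ≡ + 0) → coeff (truncate n f) ≗ f
  coeff-truncate zero    f f≡0 i       = sym (f≡0 i z≤n)
  coeff-truncate (suc n) f f≡0 zero    = refl
  coeff-truncate (suc n) f f≡0 (suc i) = coeff-truncate n (tail f) (λ k n≤k → f≡0 (suc k) (s≤s n≤k)) i

  fractionNumerator : ℕ → ℕ → Series → List ℤ
  fractionNumerator p q f = truncate (p ℕ.+ q) (D p q ⊛ tail f)

  module _ {p q : ℕ} {f : Series} (f∈V : V p q f) where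

    numerator≡0 : ∀ i → p ℕ.+ q ≤ i → (D p q ⊛ tail f) i ≡ + 0
    numerator≡0 i p+q≤i = begin
      (D p q ⊛ tail f) i
        ≡⟨ D-⊛-tail i f∈V (ℕ.m≤n⇒m≤1+n p+q≤i) ⟩
      - (D p q (suc i) * f 0)
        ≡⟨ cong (λ l → - (D p q l * f 0)) (trans (ℕ.+-suc (p ℕ.+ q) (i ∸ (p ℕ.+ q)))
                                                 (cong suc (ℕ.m+[n∸m]≡n p+q≤i))) ⟨
      - (D p q (p ℕ.+ q ℕ.+ suc (i ∸ (p ℕ.+ q))) * f 0)
        ≡⟨ cong (λ x → - (x * f 0)) (trans (D-coeff p q (suc (i ∸ (p ℕ.+ q))))
                                           (tail≡0 (E-oneS p q) (i ∸ (p ℕ.+ q)))) ⟩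
      + 0 ∎

    coeff-fractionNumerator : coeff (fractionNumerator p q f) ≗ D p q ⊛ tail f
    coeff-fractionNumerator = coeff-truncate (p ℕ.+ q) (D p q ⊛ tail f) numerator≡0

    fractionNumerator-degree : ∀ {d} → p ℕ.+ q ≡ suc d → f 0 ≢ + 0 →
                               HasDegree (fractionNumerator p q f) d
    fractionNumerator-degree {d} p+q≡ f₀≢0 =
        (λ c≡0 → top≢0 (trans (sym (coeff-fractionNumerator d)) c≡0))
      , λ i d<i → trans (coeff-fractionNumerator i) (numerator≡0 i (subst (_≤ i) (sym p+q≡) d<i))
      where
      D≢0 : D p q (suc d) ≢ + 0
      D≢0 D≡0 = head≢0 (E-oneS p q) (begin
        E p q oneS 0           ≡⟨ D-coeff p q 0 ⟨
        D p q (p ℕ.+ q ℕ.+ 0)  ≡⟨ cong (D p q) (trans (ℕ.+-identityʳ _) p+q≡) ⟩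
        D p q (suc d)          ≡⟨ D≡0 ⟩
        + 0                    ∎)
      top≢0 : (D p q ⊛ tail f) d ≢ + 0
      top≢0 top≡0 with ℤ.i*j≡0⇒i≡0∨j≡0 (D p q (suc d))
                         (ℤ.neg-injective (trans (sym (D-⊛-tail d f∈V (ℕ.≤-reflexive p+q≡))) top≡0))
      ... | inj₁ D≡0  = D≢0 D≡0
      ... | inj₂ f₀≡0 = f₀≢0 f₀≡0

  -- Evaluation at 1/2.

  fromℤ : ℤ → ℚ.ℚ
  fromℤ z = z ℚ./ 1

  toℚᵘ-fromℤ : ∀ z → ℚ.toℚᵘ (fromℤ z) ℚᵘ.≃ mkℚᵘ z 0
  toℚᵘ-fromℤ z = ℚ.toℚᵘ-fromℚᵘ (mkℚᵘ z 0)

  -- As unnormalised fractions both sides have denominator 1, and cross-multiplication turns the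
  -- claim into an identity in ℤ.
  fromℤ-linear : ∀ x y z → fromℤ (x + y * z) ≡ fromℤ x ℚ.+ fromℤ y ℚ.* fromℤ z
  fromℤ-linear x y z = ℚ.toℚᵘ-injective
    (ℚᵘ.≃-trans (toℚᵘ-fromℤ (x + y * z))
    (ℚᵘ.≃-trans (*≡* (eq x y z))
    (ℚᵘ.≃-sym
    (ℚᵘ.≃-trans (ℚ.toℚᵘ-homo-+ (fromℤ x) (fromℤ y ℚ.* fromℤ z))
                (ℚᵘ.+-cong (toℚᵘ-fromℤ x)
                           (ℚᵘ.≃-trans (ℚ.toℚᵘ-homo-* (fromℤ y) (fromℤ z))
                                       (ℚᵘ.*-cong (toℚᵘ-fromℤ y) (toℚᵘ-fromℤ z))))))))
    where
    eq : ∀ x y z → (x + y * z) * + 1 ≡ (x * + 1 + y * z * + 1) * + 1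
    eq = solve-∀

  open +-*-Solver using (solve; _:=_; con) renaming (_:+_ to _⊕_; _:*_ to _⊗_)

  -- The partial sums of ((1-2x) X)(1/2) telescope.
  evalHalf-telescope : ∀ n X y f → f 0 ≡ X 0 + - (+ 2) * y → (∀ i → f (suc i) ≡ X (suc i) + - (+ 2) * X i) →
    evalHalf (truncate (suc n) f) ≡ powQ ℚ.½ n ℚ.* fromℤ (X n) ℚ.+ fromℤ (- (+ 2)) ℚ.* fromℤ y
  evalHalf-telescope zero X y f f₀ fₛ = begin
    fromℤ (f 0) ℚ.+ ℚ.½ ℚ.* ℚ.0ℚ
      ≡⟨ cong (λ z → fromℤ z ℚ.+ ℚ.½ ℚ.* ℚ.0ℚ) f₀ ⟩
    fromℤ (X 0 + - (+ 2) * y) ℚ.+ ℚ.½ ℚ.* ℚ.0ℚ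
      ≡⟨ cong (ℚ._+ ℚ.½ ℚ.* ℚ.0ℚ) (fromℤ-linear (X 0) (- (+ 2)) y) ⟩
    (fromℤ (X 0) ℚ.+ fromℤ (- (+ 2)) ℚ.* fromℤ y) ℚ.+ ℚ.½ ℚ.* ℚ.0ℚ
      ≡⟨ solve 2 (λ u v → (u ⊕ con (fromℤ (- (+ 2))) ⊗ v) ⊕ con ℚ.½ ⊗ con ℚ.0ℚ
                       := con ℚ.1ℚ ⊗ u ⊕ con (fromℤ (- (+ 2))) ⊗ v) refl (fromℤ (X 0)) (fromℤ y) ⟩
    ℚ.1ℚ ℚ.* fromℤ (X 0) ℚ.+ fromℤ (- (+ 2)) ℚ.* fromℤ y ∎
  evalHalf-telescope (suc n) X y f f₀ fₛ = begin
    fromℤ (f 0) ℚ.+ ℚ.½ ℚ.* evalHalf (truncate (suc n) (tail f))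
      ≡⟨ cong₂ (λ u v → u ℚ.+ ℚ.½ ℚ.* v)
               (trans (cong fromℤ f₀) (fromℤ-linear (X 0) (- (+ 2)) y))
               (evalHalf-telescope n (tail X) (X 0) (tail f) (fₛ 0) (fₛ ∘ suc)) ⟩
    (fromℤ (X 0) ℚ.+ fromℤ (- (+ 2)) ℚ.* fromℤ y)
      ℚ.+ ℚ.½ ℚ.* (powQ ℚ.½ n ℚ.* fromℤ (X (suc n)) ℚ.+ fromℤ (- (+ 2)) ℚ.* fromℤ (X 0))
      ≡⟨ solve 4 (λ u v w z → (u ⊕ con (fromℤ (- (+ 2))) ⊗ v) ⊕ con ℚ.½ ⊗ (w ⊗ z ⊕ con (fromℤ (- (+ 2))) ⊗ u)
                       := (con ℚ.½ ⊗ w) ⊗ z ⊕ con (fromℤ (- (+ 2))) ⊗ v) refl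
               (fromℤ (X 0)) (fromℤ y) (powQ ℚ.½ n) (fromℤ (X (suc n))) ⟩
    (ℚ.½ ℚ.* powQ ℚ.½ n) ℚ.* fromℤ (X (suc n)) ℚ.+ fromℤ (- (+ 2)) ℚ.* fromℤ y ∎

  evalHalf-oneMinus2X : ∀ n X {f} → f ≗ oneMinus2X ⊛ X →
                        evalHalf (truncate (suc n) f) ≡ powQ ℚ.½ n ℚ.* fromℤ (X n)
  evalHalf-oneMinus2X n X {f} f≗ = trans
    -- The coefficient of X before index 0 is 0, so the boundary term disappears.
    (evalHalf-telescope n X (+ 0) f
      (trans (f≗ 0) (trans (ℤ.*-identityˡ (X 0)) (sym (ℤ.+-identityʳ (X 0)))))
      (λ i → trans (f≗ (suc i)) (trans (oneMinus2X-⊛ X i) (eq (X (suc i)) (X i)))))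
    (ℚ.+-identityʳ _)
    where
    eq : ∀ x y → x - + 2 * y ≡ x + - (+ 2) * y
    eq = solve-∀

  powQ-½-cancel : ∀ m n → powQ ℚ.½ (m ℕ.+ n) ℚ.* fromℤ (+ (2 ^ m)) ≡ powQ ℚ.½ n
  powQ-½-cancel zero    n = ℚ.*-identityʳ (powQ ℚ.½ n)
  powQ-½-cancel (suc m) n = begin
    (ℚ.½ ℚ.* powQ ℚ.½ (m ℕ.+ n)) ℚ.* fromℤ (+ (2 ^ suc m))
      ≡⟨ cong (λ z → (ℚ.½ ℚ.* powQ ℚ.½ (m ℕ.+ n)) ℚ.* fromℤ z)
              (trans (ℤ.pos-* 2 (2 ^ m)) (sym (ℤ.+-identityˡ _))) ⟩
    (ℚ.½ ℚ.* powQ ℚ.½ (m ℕ.+ n)) ℚ.* fromℤ (+ 0 + + 2 * + (2 ^ m))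
      ≡⟨ cong ((ℚ.½ ℚ.* powQ ℚ.½ (m ℕ.+ n)) ℚ.*_) (fromℤ-linear (+ 0) (+ 2) (+ (2 ^ m))) ⟩
    (ℚ.½ ℚ.* powQ ℚ.½ (m ℕ.+ n)) ℚ.* (fromℤ (+ 0) ℚ.+ fromℤ (+ 2) ℚ.* fromℤ (+ (2 ^ m)))
      ≡⟨ solve 2 (λ u v → (con ℚ.½ ⊗ u) ⊗ (con (fromℤ (+ 0)) ⊕ con (fromℤ (+ 2)) ⊗ v) := u ⊗ v) refl
               (powQ ℚ.½ (m ℕ.+ n)) (fromℤ (+ (2 ^ m))) ⟩
    powQ ℚ.½ (m ℕ.+ n) ℚ.* fromℤ (+ (2 ^ m))
      ≡⟨ powQ-½-cancel m n ⟩
    powQ ℚ.½ n ∎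

  -- The polynomials c_{r,ℓ}.

  Gcoeff-shift : ∀ r k c f → (∀ i → + g (2 ℕ.+ (suc r ℕ.+ i)) r (k ℕ.+ 2) ≡ c * f i) →
                 Gcoeff r k ≗ shiftS (r ℕ.+ 3) (scaleS c f)
  Gcoeff-shift r k c f g≡ n with ℕ.<-≤-connex n (r ℕ.+ 3)
  ... | inj₁ n<r+3 rewrite ≤ᵇ-false n<r+3 | <ᵇ-true n<r+3 = refl
  ... | inj₂ r+3≤n rewrite ≤ᵇ-true r+3≤n | <ᵇ-false r+3≤n =
    trans (cong (λ n → + g n r (k ℕ.+ 2)) (trans (sym (ℕ.m+[n∸m]≡n r+3≤n)) (eq r (n ∸ (r ℕ.+ 3)))))
          (g≡ (n ∸ (r ℕ.+ 3)))
    where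
    -- So n = r + 3 corresponds to m = r + 1, one past the starting point m = r of the sequences
    -- `a j s`; hence the tails below.
    eq : ∀ r i → r ℕ.+ 3 ℕ.+ i ≡ 2 ℕ.+ (suc r ℕ.+ i)
    eq = solveℕ-∀

  numer-shift : ∀ r k c f → (∀ i → + g (2 ℕ.+ (suc r ℕ.+ i)) r (k ℕ.+ 2) ≡ c * f i) →
                numer r k ≗ shiftS (r ℕ.+ 3) (scaleS c (D (2 ℕ.* r ∸ 1) (r ℕ.+ 1) ⊛ f))
  numer-shift r k c f g≡ n = begin
    numer r k n
      ≡⟨ ⊛-cong {f = Dᵣ} (λ _ → refl) (Gcoeff-shift r k c f g≡) n ⟩
    (Dᵣ ⊛ shiftS (r ℕ.+ 3) (scaleS c f)) n
      ≡⟨ ⊛-shiftʳ Dᵣ (r ℕ.+ 3) (scaleS c f) n ⟩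
    shiftS (r ℕ.+ 3) (Dᵣ ⊛ scaleS c f) n
      ≡⟨ shiftS-cong (r ℕ.+ 3) (⊛-scaleʳ Dᵣ c f) n ⟩
    shiftS (r ℕ.+ 3) (scaleS c (Dᵣ ⊛ f)) n ∎
    where Dᵣ = D (2 ℕ.* r ∸ 1) (r ℕ.+ 1)

  -- c_{s+1,ℓ}
  cPoly : ℕ → ℕ → List ℤ
  cPoly s zero    = fractionNumerator (suc (2 ℕ.* s)) (2 ℕ.+ s) (α s)
  cPoly s (suc l) = fractionNumerator (suc l ℕ.+ 2 ℕ.* (s ∸ l)) (suc (s ∸ l)) (a (suc l) (s ∸ l))

  numer-0 : ∀ s → numer (suc s) 0 ≗ shiftS (suc s ℕ.+ 3) (scaleS (+ 4) (coeff (cPoly s 0)))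
  numer-0 s n = trans (numer-shift (suc s) 0 (+ 4) (tail (α s)) g≡ n)
    (shiftS-cong (suc s ℕ.+ 3) (λ i → cong (+ 4 *_) (begin
      (D (2 ℕ.* suc s ∸ 1) (suc s ℕ.+ 1) ⊛ tail (α s)) i
        ≡⟨ cong₂ (λ p q → (D p q ⊛ tail (α s)) i) (ℕ.+-suc s (s ℕ.+ 0)) (ℕ.+-comm (suc s) 1) ⟩
      (D (suc (2 ℕ.* s)) (2 ℕ.+ s) ⊛ tail (α s)) i
        ≡⟨ coeff-fractionNumerator (α-V s) i ⟨
      coeff (cPoly s 0) i ∎)) n)
    where
    g≡ : ∀ i → + g (2 ℕ.+ (suc (suc s) ℕ.+ i)) (suc s) 2 ≡ + 4 * tail (α s) i
    g≡ i = begin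
      + g (2 ℕ.+ (suc (suc s) ℕ.+ i)) (suc s) 2
        ≡⟨ cong +_ (g-U-≤ (suc (suc s) ℕ.+ i) (suc s) 0 z≤n z≤n) ⟩
      -- The outer 2 comes from `g-U-≤`, the inner one is `ω 0`.
      + (2 ℕ.* (2 ℕ.* Y (suc (s ℕ.+ i)) 0 (suc s)))
        ≡⟨ cong (λ m → + (2 ℕ.* (2 ℕ.* Y m 0 (suc s)))) (sym (ℕ.+-suc s i)) ⟩
      + (2 ℕ.* (2 ℕ.* Y (s ℕ.+ suc i) 0 (suc s)))
        ≡⟨ cong +_ (sym (ℕ.*-assoc 2 2 (Y (s ℕ.+ suc i) 0 (suc s)))) ⟩
      + (4 ℕ.* Y (s ℕ.+ suc i) 0 (suc s))
        ≡⟨ ℤ.pos-* 4 (Y (s ℕ.+ suc i) 0 (suc s)) ⟩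
      + 4 * tail (α s) i ∎

  numer-suc : ∀ s l → l ≤ s → numer (suc s) (suc l) ≗ shiftS (suc s ℕ.+ 3) (scaleS (+ 2)
                (coeff (cPoly s (suc l)) ⊛ (powS oneMinusX l ⊛ powS oneMinus2X (suc l))))
  numer-suc s l l≤s n = trans (numer-shift (suc s) (suc l) (+ 2) β g≡ n)
    (shiftS-cong (suc s ℕ.+ 3) (λ i → cong (+ 2 *_) (begin
      (D (2 ℕ.* suc s ∸ 1) (suc s ℕ.+ 1) ⊛ β) i
        ≡⟨ cong₂ (λ p q → (D p q ⊛ β) i) exponent₁ exponent₂ ⟩
      (D (l ℕ.+ p) (suc l ℕ.+ q) ⊛ β) i
        ≡⟨ ⊛-cong {h = β} (D-+ l (suc l) p q) (λ _ → refl) i ⟨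
      ((D l (suc l) ⊛ D p q) ⊛ β) i
        ≡⟨ ⊛-assoc (D l (suc l)) (D p q) β i ⟩
      (D l (suc l) ⊛ (D p q ⊛ β)) i
        ≡⟨ ⊛-comm (D l (suc l)) (D p q ⊛ β) i ⟩
      ((D p q ⊛ β) ⊛ D l (suc l)) i
        ≡⟨ ⊛-cong {h = D l (suc l)} (coeff-fractionNumerator (a-V s′ (suc l))) (λ _ → refl) i ⟨
      (coeff (cPoly s (suc l)) ⊛ D l (suc l)) i ∎)) n)
    where
    s′ = s ∸ l
    p  = suc l ℕ.+ 2 ℕ.* s′
    q  = suc s′
    β  = tail (a (suc l) s′)
    exponent₁ : 2 ℕ.* suc s ∸ 1 ≡ l ℕ.+ p
    exponent₁ = trans (cong (λ s → 2 ℕ.* suc s ∸ 1) (sym (ℕ.m+[n∸m]≡n l≤s))) (eq l s′)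
      where
      eq : ∀ l s′ → l ℕ.+ s′ ℕ.+ (suc (l ℕ.+ s′ ℕ.+ 0)) ≡ l ℕ.+ (suc l ℕ.+ 2 ℕ.* s′)
      eq = solveℕ-∀
    exponent₂ : suc s ℕ.+ 1 ≡ suc l ℕ.+ q
    exponent₂ = trans (cong (λ s → suc s ℕ.+ 1) (sym (ℕ.m+[n∸m]≡n l≤s))) (eq l s′)
      where
      eq : ∀ l s′ → suc (l ℕ.+ s′) ℕ.+ 1 ≡ suc l ℕ.+ suc s′
      eq = solveℕ-∀
    g≡ : ∀ i → + g (2 ℕ.+ (suc (suc s) ℕ.+ i)) (suc s) (suc l ℕ.+ 2) ≡ + 2 * β i
    g≡ i = begin
      + g (2 ℕ.+ (suc (suc s) ℕ.+ i)) (suc s) (suc l ℕ.+ 2)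
        ≡⟨ cong +_ (g-U-≤ (suc (suc s) ℕ.+ i) (suc s) (suc l)
                      (ℕ.≤-trans (s≤s l≤s) (ℕ.≤-trans (ℕ.n≤1+n (suc s)) (ℕ.m≤m+n (suc (suc s)) i))) (s≤s l≤s)) ⟩
      + (2 ℕ.* U (suc (suc s) ℕ.+ i) (suc l) s′)
        ≡⟨ cong (λ m → + (2 ℕ.* U m (suc l) s′))
                (trans (sym (ℕ.+-suc (suc s) i)) (cong (λ m → suc m ℕ.+ suc i) (sym (ℕ.m+[n∸m]≡n l≤s)))) ⟩
      + (2 ℕ.* U (suc l ℕ.+ s′ ℕ.+ suc i) (suc l) s′)
        ≡⟨ ℤ.pos-* 2 (U (suc l ℕ.+ s′ ℕ.+ suc i) (suc l) s′) ⟩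
      + 2 * β i ∎

  numer-vanishes : ∀ r k → r < k → ∀ n → numer r k n ≡ + 0
  numer-vanishes r k r<k n = trans
    (numer-shift r k (+ 0) oneS (λ i → cong +_ (g-U-> (suc r ℕ.+ i) r k r<k)) n)
    (zeros (n <ᵇ r ℕ.+ 3))
    where
    zeros : ∀ b → (if b then + 0 else + 0) ≡ + 0
    zeros true  = refl
    zeros false = refl

  pos≢0 : ∀ {n} → n > 0 → + n ≢ + 0
  pos≢0 {suc n} _ ()

  degree-0 : ∀ s → 4 ≤ suc s → HasDegree (cPoly s 0) (3 ℕ.* suc s ∸ 1)
  degree-0 s 4≤ = fractionNumerator-degree (α-V s) (eq s) (pos≢0 (positive s 4≤))
    where
    eq : ∀ s → suc (2 ℕ.* s) ℕ.+ (2 ℕ.+ s) ≡ suc (s ℕ.+ 2 ℕ.* suc s)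
    eq = solveℕ-∀
    positive : ∀ s → 4 ≤ suc s → Y (s ℕ.+ 0) 0 (suc s) > 0
    positive (suc (suc (suc s))) _ = subst (λ m → Y m 0 (4 ℕ.+ s) > 0) (sym (ℕ.+-identityʳ (3 ℕ.+ s))) (Y-pos s)
    positive 0 (s≤s ())
    positive 1 (s≤s (s≤s ()))
    positive 2 (s≤s (s≤s (s≤s ())))

  degree-suc : ∀ s l → 4 ≤ suc s → l ≤ s → HasDegree (cPoly s (suc l)) (3 ℕ.* suc s ∸ 2 ℕ.* suc l)
  degree-suc s l 4≤ l≤s = fractionNumerator-degree (a-V s′ (suc l)) total
    (pos≢0 (subst (λ m → U m (suc l) s′ > 0) (sym (ℕ.+-identityʳ (suc l ℕ.+ s′)))
      (U-pos (suc l) s′ (subst (λ m → 4 ≤ suc m) (sym (ℕ.m+[n∸m]≡n l≤s)) 4≤))))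
    where
    s′ = s ∸ l
    split : ∀ l s′ → 3 ℕ.* suc (l ℕ.+ s′) ≡ 2 ℕ.* suc l ℕ.+ (suc l ℕ.+ 3 ℕ.* s′)
    split = solveℕ-∀
    eq : ∀ l s′ → suc l ℕ.+ 2 ℕ.* s′ ℕ.+ suc s′ ≡ suc (suc l ℕ.+ 3 ℕ.* s′)
    eq = solveℕ-∀
    total : suc l ℕ.+ 2 ℕ.* s′ ℕ.+ suc s′ ≡ suc (3 ℕ.* suc s ∸ 2 ℕ.* suc l)
    total = trans (eq l s′) (cong suc (sym (begin
      3 ℕ.* suc s ∸ 2 ℕ.* suc l
        ≡⟨ cong (λ m → 3 ℕ.* suc m ∸ 2 ℕ.* suc l) (sym (ℕ.m+[n∸m]≡n l≤s)) ⟩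
      3 ℕ.* suc (l ℕ.+ s′) ∸ 2 ℕ.* suc l
        ≡⟨ cong (_∸ 2 ℕ.* suc l) (split l s′) ⟩
      2 ℕ.* suc l ℕ.+ (suc l ℕ.+ 3 ℕ.* s′) ∸ 2 ℕ.* suc l
        ≡⟨ ℕ.m+n∸m≡n (2 ℕ.* suc l) _ ⟩
      suc l ℕ.+ 3 ℕ.* s′ ∎)))

  -- Once one factor 1 - 2x is split off, the remaining operator is one `S - 2` short of
  -- annihilating `α s`. The value is therefore the residue 2^(p+1) divided by 2^(p+q), with q = s +
  -- 1.
  evalHalf-0 : ∀ s → evalHalf (cPoly s 0) ≡ powQ ℚ.½ s
  evalHalf-0 s = begin
    evalHalf (truncate (p ℕ.+ suc q) (D p (suc q) ⊛ tail (α s)))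
      ≡⟨ cong (λ n → evalHalf (truncate n (D p (suc q) ⊛ tail (α s)))) (ℕ.+-suc p q) ⟩
    evalHalf (truncate (suc (p ℕ.+ q)) (D p (suc q) ⊛ tail (α s)))
      ≡⟨ evalHalf-oneMinus2X (p ℕ.+ q) (D p q ⊛ tail (α s)) (D-suc₂ p q (tail (α s))) ⟩
    powQ ℚ.½ (p ℕ.+ q) ℚ.* fromℤ ((D p q ⊛ tail (α s)) (p ℕ.+ q))
      ≡⟨ cong₂ (λ m z → powQ ℚ.½ m ℚ.* fromℤ z) (sym (ℕ.+-assoc p 1 s)) residue ⟩
    powQ ℚ.½ (p ℕ.+ 1 ℕ.+ s) ℚ.* fromℤ (+ (2 ^ (p ℕ.+ 1)))
      ≡⟨ powQ-½-cancel (p ℕ.+ 1) s ⟩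
    powQ ℚ.½ s ∎
    where
    p = suc (2 ℕ.* s)
    q = suc s
    residue : (D p q ⊛ tail (α s)) (p ℕ.+ q) ≡ + (2 ^ (p ℕ.+ 1))
    residue = begin
      (D p q ⊛ tail (α s)) (p ℕ.+ q)
        ≡⟨ cong (λ n → (D p q ⊛ tail (α s)) (p ℕ.+ n)) (ℕ.+-identityʳ q) ⟨
      (D p q ⊛ tail (α s)) (p ℕ.+ (q ℕ.+ 0))
        ≡⟨ D-⊛ p q (tail (α s)) 0 ⟩
      E p q (tail (α s)) 0
        ≡⟨ E-tail p q (α s) 0 ⟩
      E p q (α s) 1
        ≡⟨ residue-α s 1 ⟩
      + (2 ^ (p ℕ.+ 1)) ∎

open GeneratingFunctions

open import Data.Nat using (ℕ; _+_; _*_; _∸_; _≤_; _<_; suc; s≤s)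
open import Data.Integer using (ℤ; +_)
open import Data.List using (List)
open import Data.Product using (Σ; _×_; _,_)
open import Relation.Binary.PropositionalEquality using (_≡_)
import Data.Rational as ℚ

theorem3p6 : (r : ℕ) → 1 ≤ r →
    Σ (ℕ → List ℤ) λ c →
    ((n : ℕ) → numer r 0 n ≡ shiftS (r + 3) (scaleS (+ 4) (coeff (c 0))) n)
    × ((ℓ : ℕ) → 1 ≤ ℓ → ℓ ≤ r → (n : ℕ) →
    numer r ℓ n
    ≡ shiftS (r + 3)
    (scaleS (+ 2)
    (coeff (c ℓ) ⊛ (powS oneMinusX (ℓ ∸ 1) ⊛ powS oneMinus2X ℓ))) n)
    × ((k : ℕ) → r < k → (n : ℕ) → numer r k n ≡ + 0)
    × (4 ≤ r → HasDegree (c 0) (3 * r ∸ 1))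
    × (evalHalf (c 0) ≡ powQ ℚ.½ (r ∸ 1))
    × (4 ≤ r → (ℓ : ℕ) → 1 ≤ ℓ → ℓ ≤ r → HasDegree (c ℓ) (3 * r ∸ 2 * ℓ))
theorem3p6 (suc s) _ =
    cPoly s
  , numer-0 s
  , (λ { (suc l) _ (s≤s l≤s) → numer-suc s l l≤s })
  , numer-vanishes (suc s)
  , degree-0 s
  , evalHalf-0 s
  , (λ { 4≤ (suc l) _ (s≤s l≤s) → degree-suc s l 4≤ l≤s })
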